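{- Let $R$ be a cut-free proof-structure of the polarized fragment $\mathit{LL}_{\mathit{pol}}$ of $\mathit{MELL}$. Then $R\models\mathsf{ACC}_{\sharp\mathsf w}$ if and only if $R$ is sequentializable in $\mathit{LL}_{\mathit{pol}}$.
   Context: Formulae of $\mathit{MELL}$: $A::=X\mid\mathbf 1\mid\bot\mid A\otimes A\mid A\wp A\mid !A\mid ?A$, with $X$ ranging over a countably infinite set of atomic formulae equipped with a fixed-point-free involution $(\cdot)^\bot$ extended by De Morgan duality ($\mathbf 1/\bot$, $\otimes/\wp$, $!/?$). A fragment is a set of formulae closed under sub-formulae. $\mathit{LL}_{\mathit{pol}}$ is the fragment given (together with the sub-formulae of the generated formulae, i.e. the atoms $X$) by $$P::=\mathbf 1\mid !X\mid !N\mid P\otimes P\ \text{(positive)},\qquad N::=\bot\mid ?X\mid ?P\mid N\wp N\ \text{(negative)}.$$ Sequent calculus in a fragment $\mathcal F$ (all sequents are finite sequences of formulae of $\mathcal F$): axiom $\vdash A,A^\bot$; cut; exchange; $\otimes$ (from $\vdash\Gamma,A$ and $\vdash B,\Delta$ infer $\vdash\Gamma,A\otimes B,\Delta$); $\vdash\mathbf 1$; $\wp$ (from $\vdash\Gamma,A,B$ infer $\vdash\Gamma,A\wp B$); $\bot$ (from $\vdash\Gamma$ infer $\vdash\Gamma,\bot$); dereliction (from $\vdash\Gamma,A$ infer $\vdash\Gamma,?A$); weakening (from $\vdash\Gamma$ infer $\vdash\Gamma,?A$); contraction (from $\vdash\Gamma,?A,?A$ infer $\vdash\Gamma,?A$);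 promotion (from $\vdash ?\Gamma,A$ infer $\vdash ?\Gamma,!A$). Graphs are finite directed graphs (parallel arcs allowed, no loops); an arc is a conclusion of its tail and a premise of its head. A proof-structure (ps) of $\mathit{MELL}$ is defined inductively on depth: it is such a graph (the ground structure) without directed cycles, with nodes labelled $\mathtt{ax}$ (2 conclusions, no premise), $\mathtt{cut}$ (2 premises, no conclusion), $\mathtt 1$, $\bot$ or $?\mathtt w$ (1 conclusion, no premise), $\otimes$, $\wp$ or $?\mathtt c$ (2 premises, 1 conclusion; premises ordered for $\otimes,\wp$), $?\mathtt d$ (1 premise, 1 conclusion), $\bullet$ (1 premise, no conclusion), or box node (no premise, one principal conclusion and $k\ge0$ auxiliary conclusions), with a total order on its conclusions (the premises of $\bullet$ nodes); each box node comes with a ps (its content) of smaller depth whose conclusions are in bijection with the conclusions of the box node. Arcs are typed by formulae: dual types on the two conclusions of $\mathtt{ax}$ and the two premises of $\mathtt{cut}$; $\mathbf 1$, $\bot$, $B\otimes C$, $B\wp C$ for conclusions of $\mathtt 1,\bot,\otimes,\wp$ nodes; $?\mathtt d$ has premise of type $B$ and conclusion of type $?B$; $?\mathtt c$ has two premises and a conclusion of the same type $?B$; $?\mathtt w$ has conclusion of type $?B$; the principal conclusion of a box has type $!B$ where $B$ is the type of the corresponding conclusion of the content, and each auxiliary conclusion has a type $?C_i$ equal to the type of the corresponding conclusion of the content. It is a ps of a fragment $\mathcal F$ if all types (at every depth) are in $\mathcal F$; cut-free if it has no $\mathtt{cut}$ node at any depth. A switching $\varphi$ of the ground structure maps each $\wp$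 and each $?\mathtt c$ node to one of its premises; the switching graph is obtained by redirecting the head of the other premise of each such node to a fresh $\bullet$ node (box nodes are treated as single nodes). $R\models\mathsf{ACC}_{\sharp\mathsf w}$ means: for every switching of the ground structure, the switching graph has no undirected cycle and its number of connected components equals (number of $\bot$ and $?\mathtt w$ nodes of the ground structure) $+1$, and, inductively, the content of every box satisfies $\mathsf{ACC}_{\sharp\mathsf w}$. Desequentialization $\pi\mapsto\pi^\circ$ maps a sequent calculus proof to a ps in the usual way, by induction on $\pi$: an axiom/$\mathbf 1$ rule gives a single $\mathtt{ax}$/$\mathtt 1$ node with conclusions pointing to $\bullet$ nodes; exchange permutes the conclusions; $\bot$ and weakening rules add disjointly a $\bot$ or $?\mathtt w$ node with conclusion pointing to a $\bullet$ node; $\wp$, contraction and dereliction rules add a $\wp$, $?\mathtt c$, $?\mathtt d$ node below the active conclusion(s); $\otimes$ and cut rules join the two disjoint ps by a $\otimes$ or $\mathtt{cut}$ node below the active conclusions; a promotion rule gives a single box node with conclusions pointing to $\bullet$ nodes, whose content is the ps of the premise. $R$ is sequentializable in $\mathcal F$ if $R=\pi^\circ$ (up to isomorphism) for some sequent calculus proof $\pi$ in $\mathcal F$. -}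

module Defs where

open import Data.Fin.Base as Fin using (Fin; zero; suc; toℕ; join; splitAt)
open import Data.Fin.Patterns using (0F; 1F)
open import Data.Fin.Permutation using (Permutation; Permutation′; id; flip; _∘ₚ_; _⟨$⟩ʳ_; _⟨$⟩ˡ_; inverseʳ; cast-id)
open import Data.Fin.Properties using (_≟_; +↔⊎; 1↔⊤; splitAt-join; join-splitAt)
open import Data.List.Base as List using (List)
open import Data.List.Relation.Unary.Unique.Propositional using (Unique)
open import Data.Nat.Base using (ℕ; suc; _+_)
open import Data.Nat.Properties using (+-assoc)
open import Data.Product using (Σ; Σ-syntax; ∃-syntax; ∃₂; _×_; _,_; proj₁; proj₂)
open import Data.Sum as Sum using (_⊎_; inj₁; inj₂; [_,_]′)
open import Data.Sum.Algebra using (⊎-comm)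
open import Data.Sum.Function.Propositional using (_⊎-↔_)
open import Data.Unit.Base using (⊤; tt)
open import Data.Vec.Base using (Vec; []; _∷_; _++_; lookup; map; tabulate; count)
open import Data.Vec.Properties using (lookup-splitAt; lookup-map; lookup-cast; ++-assoc-eqFree)
open import Data.Vec.Relation.Unary.All using (All)
open import Function.Base using (_∘_)
open import Function.Bundles using (_↔_; _⇔_; Inverse; mk↔ₛ′)
open import Function.Definitions using (Surjective)
open import Function.Properties.Inverse using (↔-refl; ↔-sym; ↔-trans)
open import Function.Related.TypeIsomorphisms using (Σ-distribʳ-⊎)
open import Relation.Binary.Construct.Closure.Equivalence using (EqClosure)
open import Relation.Binary.Construct.Closure.Transitive using (TransClosure; [_]; _∷_)
open import Relation.Binary.PropositionalEquality using (_≡_; _≢_; refl; sym; trans; cong; subst)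
open import Relation.Nullary using (¬_; yes; no; contradiction)
open import Relation.Unary using (Decidable)

open Inverse using (to; from)

private
  variable
    m n k : ℕ

record Digraph : Set₁ where
  field
    Vertex Arc : Set
    tail head  : Arc → Vertex

  _⟶_ : Vertex → Vertex → Set
  x ⟶ y = Σ[ a ∈ Arc ] tail a ≡ x × head a ≡ y

  Acyclic : Set
  Acyclic = ∀ x → ¬ TransClosure _⟶_ x x

  Joins : Arc → Vertex → Vertex → Set
  Joins a x y = (tail a ≡ x × head a ≡ y) ⊎ (tail a ≡ y × head a ≡ x)

  data Walk : Vertex → Vertex → Set where
    []   : ∀ {x} → Walk x x
    step : ∀ {x y z} (a : Arc) → Joins a x y → Walk y z → Walk x z

  arcs : ∀ {x y} → Walk x y → List Arc
  arcs []           = List.[]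
  arcs (step a _ w) = a List.∷ arcs w

  -- The endpoint is left out, so that a cycle may repeat its base there.
  vertices : ∀ {x y} → Walk x y → List Vertex
  vertices []               = List.[]
  vertices (step {x} _ _ w) = x List.∷ vertices w

  -- Two parallel arcs form a cycle.
  record UndirectedCycle : Set where
    field
      {base}          : Vertex
      walk            : Walk base base
      nonempty        : arcs walk ≢ List.[]
      unique-arcs     : Unique (arcs walk)
      unique-vertices : Unique (vertices walk)

  Connected : Vertex → Vertex → Set
  Connected = EqClosure _⟶_

  record HasComponents (c : ℕ) : Set where
    field
      component  : Vertex → Fin c
      surjective : Surjective _≡_ _≡_ component
      classifies : ∀ x y → Connected x y ⇔ component x ≡ component y

-- Labels of the nodes other than ●.

data Label : Set where
  ax cut one bot tensor par der wkn ctr : Label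
  box : (k : ℕ) → Label                   -- k auxiliary conclusions

#in : Label → ℕ
#in ax      = 0
#in cut     = 2
#in one     = 0
#in bot     = 0
#in tensor  = 2
#in par     = 2
#in der     = 1
#in wkn     = 0
#in ctr     = 2
#in (box k) = 0

#out : Label → ℕ
#out ax      = 2
#out cut     = 0
#out one     = 1
#out bot     = 1
#out tensor  = 1
#out par     = 1
#out der     = 1
#out wkn     = 1
#out ctr     = 1
#out (box k) = suc k                      -- conclusion 0 is the principal one

data Switched : Label → Set where
  par : Switched par
  ctr : Switched ctr

switched? : Decidable Switched
switched? ax      = no λ ()
switched? cut     = no λ ()
switched? one     = no λ ()
switched? bot     = no λ ()
switched? tensor  = no λ ()
switched? par     = yes par
switched? der     = no λ ()
switched? wkn     = no λ ()
switched? ctr     = yes ctr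
switched? (box k) = no λ ()

data Weakening : Label → Set where
  bot : Weakening bot
  wkn : Weakening wkn

weakening? : Decidable Weakening
weakening? ax      = no λ ()
weakening? cut     = no λ ()
weakening? one     = no λ ()
weakening? bot     = yes bot
weakening? tensor  = no λ ()
weakening? par     = no λ ()
weakening? der     = no λ ()
weakening? wkn     = yes wkn
weakening? ctr     = no λ ()
weakening? (box k) = no λ ()

data Ordered : Label → Set where
  tensor : Ordered tensor
  par    : Ordered par

-- Every arc is a conclusion of exactly one node, hence an arc is given as
-- a node (never a ●) together with one of its conclusion ports.  Since each
-- ● node has one premise and no conclusion, and the ● nodes are totally
-- ordered, they are the elements of Fin n.  The numbering of the ports is
-- significant only for premises of ⊗ and ⅋ and for the principal conclusion
-- of a box; isomorphisms forget the rest of it.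

Arcs : {Node : Set} → (Node → Label) → Set
Arcs label = Σ[ v ∈ _ ] Fin (#out (label v))

Targets : {Node : Set} → (Node → Label) → ℕ → Set
Targets label n = (Σ[ v ∈ _ ] Fin (#in (label v))) ⊎ Fin n

wiring : {Node : Set} (label : Node → Label) → Arcs label ↔ Targets label n → Digraph
wiring {n} {Node} label target = record
  { Vertex = Node ⊎ Fin n
  ; Arc    = Arcs label
  ; tail   = inj₁ ∘ proj₁
  ; head   = Sum.map₁ proj₁ ∘ to target
  }

record Atoms : Set₁ where
  field
    Atom             : Set
    countable        : Atom ↔ ℕ
    dualAtom         : Atom → Atom
    involutive       : ∀ X → dualAtom (dualAtom X) ≡ X
    fixed-point-free : ∀ X → dualAtom X ≢ X

module _ {Node : Set} (label : Node → Label) {n : ℕ} (target : Arcs label ↔ Targets label n) where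

  open Digraph (wiring label target)

  _↝_ : Node → Node → Set
  v ↝ w = ∃₂ λ p q → to target (v , p) ≡ inj₁ (w , q)

  step↝ : ∀ {x w} → x ⟶ inj₁ w → ∃[ v ] x ≡ inj₁ v × v ↝ w
  step↝ ((v , p) , refl , e) with to target (v , p) in eq | e
  ... | inj₁ (w , q) | refl = v , refl , p , q , eq

  path↝ : ∀ {x w} → TransClosure _⟶_ x (inj₁ w) → ∃[ v ] x ≡ inj₁ v × TransClosure _↝_ v w
  path↝ [ s ] with step↝ s
  ... | v , refl , t = v , refl , [ t ]
  path↝ (s ∷ ss) with path↝ ss
  ... | u , refl , ts with step↝ s
  ... | v , refl , t = v , refl , t ∷ ts

  path⟶ : ∀ {v w} → TransClosure _↝_ v w → TransClosure _⟶_ (inj₁ v) (inj₁ w)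
  path⟶ [ p , q , e ] = [ (_ , p) , refl , cong (Sum.map₁ proj₁) e ]
  path⟶ ((p , q , e) ∷ ts) = ((_ , p) , refl , cong (Sum.map₁ proj₁) e) ∷ path⟶ ts

  acyclic : (∀ v → ¬ TransClosure _↝_ v v) → Acyclic
  acyclic h (inj₁ v) c with path↝ c
  ... | _ , refl , c′ = h v c′
  acyclic h (inj₂ i) [ _ , () , _ ]
  acyclic h (inj₂ i) ((_ , () , _) ∷ _)

  acyclic↝ : Acyclic → ∀ v → ¬ TransClosure _↝_ v v
  acyclic↝ h v c = h (inj₁ v) (path⟶ c)

Σ-⊤ : {P : ⊤ → Set} → Σ ⊤ P ↔ P tt
Σ-⊤ = mk↔ₛ′ proj₂ (tt ,_) (λ _ → refl) (λ _ → refl)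

⊎-identityʳ′ : {A B : Set} → ¬ B → (A ⊎ B) ↔ A
⊎-identityʳ′ ¬b = mk↔ₛ′ (λ { (inj₁ a) → a ; (inj₂ b) → contradiction b ¬b }) inj₁ (λ _ → refl)
                         (λ { (inj₁ a) → refl ; (inj₂ b) → contradiction b ¬b })

interchange : {A B C D : Set} → ((A ⊎ B) ⊎ (C ⊎ D)) ↔ ((A ⊎ C) ⊎ (B ⊎ D))
interchange = mk↔ₛ′ f f inv inv
  where
  f : {A B C D : Set} → (A ⊎ B) ⊎ (C ⊎ D) → (A ⊎ C) ⊎ (B ⊎ D)
  f (inj₁ (inj₁ a)) = inj₁ (inj₁ a)
  f (inj₁ (inj₂ b)) = inj₂ (inj₁ b)
  f (inj₂ (inj₁ c)) = inj₁ (inj₂ c)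
  f (inj₂ (inj₂ d)) = inj₂ (inj₂ d)
  inv : {A B C D : Set} (x : (A ⊎ B) ⊎ (C ⊎ D)) → f (f x) ≡ x
  inv (inj₁ (inj₁ a)) = refl
  inv (inj₁ (inj₂ b)) = refl
  inv (inj₂ (inj₁ c)) = refl
  inv (inj₂ (inj₂ d)) = refl

-- Old targets S, new premises I, new conclusions O, other conclusions M and N.
plug : {S M I N O : Set} → ((S ⊎ (M ⊎ (I ⊎ N))) ⊎ O) ↔ ((S ⊎ I) ⊎ (M ⊎ (O ⊎ N)))
plug = mk↔ₛ′
  (λ { (inj₁ (inj₁ s))               → inj₁ (inj₁ s)
     ; (inj₁ (inj₂ (inj₁ m)))        → inj₂ (inj₁ m)
     ; (inj₁ (inj₂ (inj₂ (inj₁ i)))) → inj₁ (inj₂ i)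
     ; (inj₁ (inj₂ (inj₂ (inj₂ n)))) → inj₂ (inj₂ (inj₂ n))
     ; (inj₂ o)                      → inj₂ (inj₂ (inj₁ o)) })
  (λ { (inj₁ (inj₁ s))        → inj₁ (inj₁ s)
     ; (inj₁ (inj₂ i))        → inj₁ (inj₂ (inj₂ (inj₁ i)))
     ; (inj₂ (inj₁ m))        → inj₁ (inj₂ (inj₁ m))
     ; (inj₂ (inj₂ (inj₁ o))) → inj₂ o
     ; (inj₂ (inj₂ (inj₂ n))) → inj₁ (inj₂ (inj₂ (inj₂ n))) })
  (λ { (inj₁ (inj₁ s)) → refl ; (inj₁ (inj₂ i)) → refl ; (inj₂ (inj₁ m)) → refl
     ; (inj₂ (inj₂ (inj₁ o))) → refl ; (inj₂ (inj₂ (inj₂ n))) → refl })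
  (λ { (inj₁ (inj₁ s)) → refl ; (inj₁ (inj₂ (inj₁ m))) → refl
     ; (inj₁ (inj₂ (inj₂ (inj₁ i)))) → refl ; (inj₁ (inj₂ (inj₂ (inj₂ n)))) → refl
     ; (inj₂ o) → refl })

split₃ : ∀ m k n → Fin (m + (k + n)) ↔ (Fin m ⊎ (Fin k ⊎ Fin n))
split₃ m k n = ↔-trans (+↔⊎ {m} {k + n}) (↔-refl ⊎-↔ +↔⊎ {k} {n})

module _ {A : Set} where

  lookup-join : (xs : Vec A m) (ys : Vec A n) (s : Fin m ⊎ Fin n) →
                lookup (xs ++ ys) (join m n s) ≡ [ lookup xs , lookup ys ]′ s
  lookup-join {m} {n} xs ys s =
    trans (lookup-splitAt m xs ys (join m n s)) (cong [ lookup xs , lookup ys ]′ (splitAt-join m n s))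

  lookup-split₃ : (xs : Vec A m) (ys : Vec A k) (zs : Vec A n) (i : Fin (m + (k + n))) →
                  lookup (xs ++ ys ++ zs) i ≡
                  [ lookup xs , [ lookup ys , lookup zs ]′ ]′ (to (split₃ m k n) i)
  lookup-split₃ {m} {k} {n} xs ys zs i
    with to (+↔⊎ {m} {k + n}) i | lookup-splitAt m xs (ys ++ zs) i
  ... | inj₁ j | e = e
  ... | inj₂ j | e = trans e (lookup-splitAt k ys zs j)

module MELL (𝒜 : Atoms) where

  open Atoms 𝒜

  infix  9 _^⊥
  infix  8 !_ ⁇_
  infixr 7 _⊗_
  infixr 6 _⅋_

  data Formula : Set where
    atom    : Atom → Formula
    𝟏 ⊥′    : Formula
    _⊗_ _⅋_ : Formula → Formula → Formula
    !_ ⁇_   : Formula → Formula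

  private
    variable
      A B : Formula
      Γ : Vec Formula m
      Δ : Vec Formula n

  _^⊥ : Formula → Formula
  atom X ^⊥  = atom (dualAtom X)
  𝟏 ^⊥       = ⊥′
  ⊥′ ^⊥      = 𝟏
  (A ⊗ B) ^⊥ = A ^⊥ ⅋ B ^⊥
  (A ⅋ B) ^⊥ = A ^⊥ ⊗ B ^⊥
  (! A) ^⊥   = ⁇ (A ^⊥)
  (⁇ A) ^⊥   = ! (A ^⊥)

  infix 4 _⊑_

  data _⊑_ (A : Formula) : Formula → Set where
    here : A ⊑ A
    ⊗ˡ   : ∀ {B C} → A ⊑ B → A ⊑ B ⊗ C
    ⊗ʳ   : ∀ {B C} → A ⊑ C → A ⊑ B ⊗ C
    ⅋ˡ   : ∀ {B C} → A ⊑ B → A ⊑ B ⅋ C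
    ⅋ʳ   : ∀ {B C} → A ⊑ C → A ⊑ B ⅋ C
    !↓   : ∀ {B} → A ⊑ B → A ⊑ ! B
    ⁇↓   : ∀ {B} → A ⊑ B → A ⊑ ⁇ B

  record Fragment : Set₁ where
    field
      Contains : Formula → Set
      closed   : A ⊑ B → Contains B → Contains A

  open Fragment public using (Contains)

  mutual
    data Positive : Formula → Set where
      𝟏     : Positive 𝟏
      !atom : ∀ X → Positive (! (atom X))
      !_    : Negative A → Positive (! A)
      _⊗_   : Positive A → Positive B → Positive (A ⊗ B)

    data Negative : Formula → Set where
      ⊥′    : Negative ⊥′
      ⁇atom : ∀ X → Negative (⁇ (atom X))
      ⁇_    : Positive A → Negative (⁇ A)
      _⅋_   : Negative A → Negative B → Negative (A ⅋ B)

  data Polarized : Formula → Set where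
    atom : ∀ X → Polarized (atom X)
    pos  : Positive A → Polarized A
    neg  : Negative A → Polarized A

  polarized-closed : A ⊑ B → Polarized B → Polarized A
  polarized-closed here   b                 = b
  polarized-closed (⊗ˡ s) (pos (p ⊗ _))     = polarized-closed s (pos p)
  polarized-closed (⊗ʳ s) (pos (_ ⊗ p))     = polarized-closed s (pos p)
  polarized-closed (⅋ˡ s) (neg (p ⅋ _))     = polarized-closed s (neg p)
  polarized-closed (⅋ʳ s) (neg (_ ⅋ p))     = polarized-closed s (neg p)
  polarized-closed (!↓ s) (pos (!atom X))   = polarized-closed s (atom X)
  polarized-closed (!↓ s) (pos (! p))       = polarized-closed s (neg p)
  polarized-closed (⁇↓ s) (neg (⁇atom X))   = polarized-closed s (atom X)
  polarized-closed (⁇↓ s) (neg (⁇ p))       = polarized-closed s (pos p)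

  LLpol : Fragment
  LLpol = record { Contains = Polarized ; closed = polarized-closed }

  data Proof : ∀ {n} → Vec Formula n → Set where
    axiom       : ∀ A → Proof (A ∷ A ^⊥ ∷ [])
    cut-rule    : Proof (Γ ++ A ∷ []) → Proof (A ^⊥ ∷ Δ) → Proof (Γ ++ Δ)
    exchange    : (σ : Permutation m n) {Γ : Vec Formula m} {Δ : Vec Formula n} →
                  (∀ i → lookup Δ (σ ⟨$⟩ʳ i) ≡ lookup Γ i) → Proof Γ → Proof Δ
    ⊗-rule      : Proof (Γ ++ A ∷ []) → Proof (B ∷ Δ) → Proof (Γ ++ A ⊗ B ∷ Δ)
    𝟏-rule      : Proof (𝟏 ∷ [])
    ⅋-rule      : Proof (Γ ++ A ∷ B ∷ []) → Proof (Γ ++ A ⅋ B ∷ [])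
    ⊥-rule      : Proof Γ → Proof (Γ ++ ⊥′ ∷ [])
    dereliction : Proof (Γ ++ A ∷ []) → Proof (Γ ++ ⁇ A ∷ [])
    weakening   : Proof Γ → Proof (Γ ++ ⁇ A ∷ [])
    contraction : Proof (Γ ++ ⁇ A ∷ ⁇ A ∷ []) → Proof (Γ ++ ⁇ A ∷ [])
    promotion   : Proof (map ⁇_ Γ ++ A ∷ []) → Proof (map ⁇_ Γ ++ ! A ∷ [])

  module _ (ℱ : Fragment) where

    private
      In : Vec Formula n → Set
      In = All (Contains ℱ)

    AllSequentsIn : Proof Γ → Set
    AllSequentsIn {Γ = Γ} (axiom A)        = In Γ
    AllSequentsIn {Γ = Γ} (cut-rule π π′)  = In Γ × AllSequentsIn π × AllSequentsIn π′
    AllSequentsIn {Γ = Γ} (exchange σ _ π) = In Γ × AllSequentsIn π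
    AllSequentsIn {Γ = Γ} (⊗-rule π π′)    = In Γ × AllSequentsIn π × AllSequentsIn π′
    AllSequentsIn {Γ = Γ} 𝟏-rule           = In Γ
    AllSequentsIn {Γ = Γ} (⅋-rule π)       = In Γ × AllSequentsIn π
    AllSequentsIn {Γ = Γ} (⊥-rule π)       = In Γ × AllSequentsIn π
    AllSequentsIn {Γ = Γ} (dereliction π)  = In Γ × AllSequentsIn π
    AllSequentsIn {Γ = Γ} (weakening π)    = In Γ × AllSequentsIn π
    AllSequentsIn {Γ = Γ} (contraction π)  = In Γ × AllSequentsIn π
    AllSequentsIn {Γ = Γ} (promotion π)    = In Γ × AllSequentsIn π

  -- Typing constraint relating the types of the premises and of the
  -- conclusions of a node; for a box node it is completed by the
  -- constraints in Content below.
  Typed : (ℓ : Label) → (Fin (#in ℓ) → Formula) → (Fin (#out ℓ) → Formula) → Set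
  Typed ax      i o = o 1F ≡ o 0F ^⊥
  Typed cut     i o = i 1F ≡ i 0F ^⊥
  Typed one     i o = o 0F ≡ 𝟏
  Typed bot     i o = o 0F ≡ ⊥′
  Typed tensor  i o = o 0F ≡ i 0F ⊗ i 1F
  Typed par     i o = o 0F ≡ i 0F ⅋ i 1F
  Typed der     i o = o 0F ≡ ⁇ i 0F
  Typed wkn     i o = ∃[ B ] o 0F ≡ ⁇ B
  Typed ctr     i o = ∃[ B ] o 0F ≡ ⁇ B × i 0F ≡ ⁇ B × i 1F ≡ ⁇ B
  Typed (box k) i o = (∃[ B ] o zero ≡ ! B) × (∀ j → ∃[ C ] o (suc j) ≡ ⁇ C)

  -- Ground structures whose conclusions have, in order, the types Γ.
  record Ground {n : ℕ} (Γ : Vec Formula n) : Set₁ where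
    field
      Node   : Set
      size   : ℕ
      nodes  : Fin size ↔ Node
      label  : Node → Label
      target : Arcs label ↔ Targets label n

    Arc : Set
    Arc = Arcs label

    premise : (v : Node) → Fin (#in (label v)) → Arc
    premise v p = from target (inj₁ (v , p))

    conclusion : (v : Node) → Fin (#out (label v)) → Arc
    conclusion v p = v , p

    -- The premise of the i-th ● node.
    outer : Fin n → Arc
    outer i = from target (inj₂ i)

    graph : Digraph
    graph = wiring label target

    open Digraph graph public using (Vertex; head; tail)

    field
      type       : Arc → Formula
      typed      : ∀ v → Typed (label v) (type ∘ premise v) (type ∘ conclusion v)
      outer-type : ∀ i → type (outer i) ≡ lookup Γ i
      no-cycle   : Digraph.Acyclic graph

    conclusionOfBox : ∀ v → label v ≡ box k → Fin (suc k) → Arc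
    conclusionOfBox v e p = conclusion v (subst (Fin ∘ #out) (sym e) p)

  mutual
    record ProofStructure {n : ℕ} (Γ : Vec Formula n) : Set₁ where
      inductive
      no-eta-equality
      pattern
      constructor ps
      field
        ground  : Ground Γ
        content : ∀ v {k} (e : Ground.label ground v ≡ box k) → Content ground v e

    -- The order of the conclusions of the content is unrelated to the
    -- chosen numbering of the conclusions of the box: door relates them.
    record Content {n : ℕ} {Γ : Vec Formula n} (G : Ground Γ)
                   (v : Ground.Node G) {k : ℕ} (e : Ground.label G v ≡ box k) : Set₁ where
      inductive
      no-eta-equality
      pattern
      constructor boxContent
      open Ground G
      field
        {width}        : ℕ
        {Θ}            : Vec Formula width
        body           : ProofStructure Θ
        door           : Permutation (suc k) width
        principal-type : type (conclusionOfBox v e zero) ≡ ! lookup Θ (door ⟨$⟩ʳ zero)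
        auxiliary-type : ∀ j → type (conclusionOfBox v e (suc j)) ≡ lookup Θ (door ⟨$⟩ʳ suc j)

  open ProofStructure

  record Everywhere (P : ∀ {n} {Γ : Vec Formula n} → Ground Γ → Set)
                    {n : ℕ} {Γ : Vec Formula n} (R : ProofStructure Γ) : Set where
    inductive
    field
      at-ground : P (ground R)
      in-boxes  : ∀ v {k} (e : Ground.label (ground R) v ≡ box k) → Everywhere P (Content.body (content R v e))

  CutFree : ProofStructure Γ → Set
  CutFree = Everywhere λ G → let open Ground G in ∀ v → label v ≢ cut

  PSOf : Fragment → ProofStructure Γ → Set
  PSOf ℱ = Everywhere λ G → let open Ground G in ∀ a → Contains ℱ (type a)

  module _ {n : ℕ} {Γ : Vec Formula n} (G : Ground Γ) where

    open Ground G

    Switching : Set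
    Switching = ∀ v → Switched (label v) → Fin (#in (label v))

    SwitchingVertex : Set
    SwitchingVertex = Vertex ⊎ (Σ[ v ∈ Node ] Switched (label v))

    redirect : Switching → Targets label n → SwitchingVertex
    redirect φ (inj₂ i)       = inj₁ (inj₂ i)
    redirect φ (inj₁ (v , p)) with switched? (label v)
    ... | no _  = inj₁ (inj₁ v)
    ... | yes s with φ v s ≟ p
    ...   | yes _ = inj₁ (inj₁ v)
    ...   | no _  = inj₂ (v , s)

    -- Exactly one premise of each ⅋ and ?c node is redirected, so the fresh
    -- ● nodes are indexed by these nodes.
    switchingGraph : Switching → Digraph
    switchingGraph φ = record
      { Vertex = SwitchingVertex
      ; Arc    = Arc
      ; tail   = inj₁ ∘ tail
      ; head   = redirect φ ∘ to target
      }

    #w : ℕ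
    #w = count weakening? (tabulate (label ∘ to nodes))

    ACC♯w-ground : Set
    ACC♯w-ground = (φ : Switching) → let open Digraph (switchingGraph φ) in
                   ¬ UndirectedCycle × HasComponents (#w + 1)

  ACC♯w : ProofStructure Γ → Set
  ACC♯w = Everywhere ACC♯w-ground

  -- R ≅⟨ σ ⟩ S: an isomorphism sending the i-th conclusion of R to the
  -- σ(i)-th conclusion of S.  The numbering of the ports is preserved only
  -- for the premises of ⊗ and ⅋ nodes.  Contents of boxes need only be
  -- isomorphic compatibly with the conclusions of the boxes: ρ is the
  -- permutation of these conclusions induced by the isomorphism.
  infix 4 _≅⟨_⟩_

  record _≅⟨_⟩_ {m n : ℕ} {Γ : Vec Formula m} {Δ : Vec Formula n}
                (R : ProofStructure Γ) (σ : Permutation m n) (S : ProofStructure Δ) : Set where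
    inductive
    private
      module R = Ground (ground R)
      module S = Ground (ground S)
    field
      node-iso   : R.Node ↔ S.Node
      arc-iso    : R.Arc ↔ S.Arc
      label-iso  : ∀ v → S.label (to node-iso v) ≡ R.label v
      type-iso   : ∀ a → S.type (to arc-iso a) ≡ R.type a
      tail-iso   : ∀ a → S.tail (to arc-iso a) ≡ Sum.map (to node-iso) (σ ⟨$⟩ʳ_) (R.tail a)
      head-iso   : ∀ a → S.head (to arc-iso a) ≡ Sum.map (to node-iso) (σ ⟨$⟩ʳ_) (R.head a)
      order-iso  : ∀ {a v p w q} → Ordered (R.label v) →
                   to R.target a ≡ inj₁ (v , p) → to S.target (to arc-iso a) ≡ inj₁ (w , q) →
                   toℕ q ≡ toℕ p
      box-iso    : ∀ v {k} (e : R.label v ≡ box k) →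
                   let w = to node-iso v ; e′ = trans (label-iso v) e in
                   Σ[ ρ ∈ Permutation′ (suc k) ]
                     ρ ⟨$⟩ʳ zero ≡ zero ×
                     (∀ p → to arc-iso (R.conclusionOfBox v e p) ≡ S.conclusionOfBox w e′ (ρ ⟨$⟩ʳ p)) ×
                     (Content.body (content R v e)
                       ≅⟨ flip (Content.door (content R v e)) ∘ₚ ρ ∘ₚ Content.door (content S w e′) ⟩
                      Content.body (content S w e′))

  infix 4 _≅_

  _≅_ : ProofStructure Γ → ProofStructure Γ → Set
  R ≅ S = R ≅⟨ id ⟩ S

  Typed-cong : ∀ ℓ {i i′ : Fin (#in ℓ) → Formula} {o o′ : Fin (#out ℓ) → Formula} →
               (∀ p → i p ≡ i′ p) → (∀ p → o p ≡ o′ p) → Typed ℓ i o → Typed ℓ i′ o′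
  Typed-cong ax      hi ho t rewrite ho 0F | ho 1F           = t
  Typed-cong cut     hi ho t rewrite hi 0F | hi 1F           = t
  Typed-cong one     hi ho t rewrite ho 0F                   = t
  Typed-cong bot     hi ho t rewrite ho 0F                   = t
  Typed-cong tensor  hi ho t rewrite ho 0F | hi 0F | hi 1F   = t
  Typed-cong par     hi ho t rewrite ho 0F | hi 0F | hi 1F   = t
  Typed-cong der     hi ho t rewrite ho 0F | hi 0F           = t
  Typed-cong wkn     hi ho t rewrite ho 0F                   = t
  Typed-cong ctr     hi ho t rewrite ho 0F | hi 0F | hi 1F   = t
  Typed-cong (box k) hi ho ((B , b) , t) =
    (B , trans (sym (ho zero)) b) , λ j → proj₁ (t j) , trans (sym (ho (suc j))) (proj₂ (t j))

  module Reorder {m n : ℕ} {Γ : Vec Formula m} {Δ : Vec Formula n} (σ : Permutation m n)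
                 (σ-type : ∀ i → lookup Δ (σ ⟨$⟩ʳ i) ≡ lookup Γ i) (G : Ground Γ) where

    open Ground G using (Node; size; nodes; label; type; typed)
    private module G = Ground G

    target : Arcs label ↔ Targets label n
    target = ↔-trans G.target (↔-refl ⊎-↔ σ)

    unstep : ∀ {v w} → _↝_ label target v w → _↝_ label G.target v w
    unstep {v} (p , q , e) with to G.target (v , p) in eq | e
    ... | inj₁ _ | refl = p , q , eq

    unpath : ∀ {v w} → TransClosure (_↝_ label target) v w → TransClosure (_↝_ label G.target) v w
    unpath [ s ]    = [ unstep s ]
    unpath (s ∷ ss) = unstep s ∷ unpath ss

    result : Ground Δ
    result = record
      { Node = Node ; size = size ; nodes = nodes ; label = label ; target = target ; type = type
      ; typed = typed
      ; outer-type = λ i → trans (G.outer-type (σ ⟨$⟩ˡ i))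
                             (trans (sym (σ-type (σ ⟨$⟩ˡ i))) (cong (lookup Δ) (inverseʳ σ)))
      ; no-cycle = acyclic label target λ v → acyclic↝ label G.target G.no-cycle v ∘ unpath
      }

  reorder : {Γ : Vec Formula m} {Δ : Vec Formula n} (σ : Permutation m n) →
            (∀ i → lookup Δ (σ ⟨$⟩ʳ i) ≡ lookup Γ i) → ProofStructure Γ → ProofStructure Δ
  reorder σ σ-type R = ps (Reorder.result σ σ-type (ground R)) λ v e →
    let open Content (content R v e) in boxContent body door principal-type auxiliary-type

  module Single (ℓ : Label) (Θ : Vec Formula (#out ℓ)) (no-premise : ¬ Fin (#in ℓ))
                (t : ∀ i → Typed ℓ i (lookup Θ)) where

    label : ⊤ → Label
    label _ = ℓ

    target : Arcs label ↔ Targets label (#out ℓ)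
    target = ↔-trans Σ-⊤ (↔-sym (↔-trans (⊎-comm _ _) (⊎-identityʳ′ (no-premise ∘ proj₂))))

    premise : ∀ {v w} → TransClosure (_↝_ label target) v w → Fin (#in ℓ)
    premise [ _ , q , _ ]     = q
    premise ((_ , q , _) ∷ _) = q

    result : Ground Θ
    result = record
      { Node = ⊤ ; size = 1 ; nodes = 1↔⊤ ; label = label ; target = target ; type = lookup Θ ∘ proj₂
      ; typed = λ _ → t _ ; outer-type = λ _ → refl
      ; no-cycle = acyclic label target λ v → no-premise ∘ premise
      }

  single : (ℓ : Label) (Θ : Vec Formula (#out ℓ)) → ¬ Fin (#in ℓ) → (∀ k → ℓ ≢ box k) →
           (∀ i → Typed ℓ i (lookup Θ)) → ProofStructure Θ
  single ℓ Θ no-premise no-box t =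
    ps (Single.result ℓ Θ no-premise t) λ _ e → contradiction e (no-box _)

  module Juxtapose {m n : ℕ} {Γ : Vec Formula m} {Δ : Vec Formula n}
                   (G₁ : Ground Γ) (G₂ : Ground Δ) where
    module G₁ = Ground G₁
    module G₂ = Ground G₂

    label : G₁.Node ⊎ G₂.Node → Label
    label = [ G₁.label , G₂.label ]′

    target : Arcs label ↔ Targets label (m + n)
    target = ↔-trans Σ-distribʳ-⊎ (↔-trans (G₁.target ⊎-↔ G₂.target)
               (↔-trans interchange (↔-sym Σ-distribʳ-⊎ ⊎-↔ ↔-sym +↔⊎)))

    type : Arcs label → Formula
    type (inj₁ v , p) = G₁.type (v , p)
    type (inj₂ v , p) = G₂.type (v , p)

    step₁ : ∀ {v w} → _↝_ label target (inj₁ v) w →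
            ∃[ u ] w ≡ inj₁ u × _↝_ G₁.label G₁.target v u
    step₁ {v} (p , q , e) with to G₁.target (v , p) in eq | e
    ... | inj₁ (u , r) | refl = u , refl , p , r , eq

    step₂ : ∀ {v w} → _↝_ label target (inj₂ v) w →
            ∃[ u ] w ≡ inj₂ u × _↝_ G₂.label G₂.target v u
    step₂ {v} (p , q , e) with to G₂.target (v , p) in eq | e
    ... | inj₁ (u , r) | refl = u , refl , p , r , eq

    path₁ : ∀ {v w} → TransClosure (_↝_ label target) (inj₁ v) w →
            ∃[ u ] w ≡ inj₁ u × TransClosure (_↝_ G₁.label G₁.target) v u
    path₁ [ s ] with step₁ s
    ... | u , refl , t = u , refl , [ t ]
    path₁ (s ∷ ss) with step₁ s
    ... | u , refl , t with path₁ ss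
    ... | x , refl , ts = x , refl , t ∷ ts

    path₂ : ∀ {v w} → TransClosure (_↝_ label target) (inj₂ v) w →
            ∃[ u ] w ≡ inj₂ u × TransClosure (_↝_ G₂.label G₂.target) v u
    path₂ [ s ] with step₂ s
    ... | u , refl , t = u , refl , [ t ]
    path₂ (s ∷ ss) with step₂ s
    ... | u , refl , t with path₂ ss
    ... | x , refl , ts = x , refl , t ∷ ts

    no-cycle : ∀ v → ¬ TransClosure (_↝_ label target) v v
    no-cycle (inj₁ v) c with path₁ c
    ... | _ , refl , c′ = acyclic↝ G₁.label G₁.target G₁.no-cycle v c′
    no-cycle (inj₂ v) c with path₂ c
    ... | _ , refl , c′ = acyclic↝ G₂.label G₂.target G₂.no-cycle v c′

    outer-type : ∀ s → type (from target (inj₂ (join m n s))) ≡ [ lookup Γ , lookup Δ ]′ s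
    outer-type s rewrite splitAt-join m n s with s
    ... | inj₁ i = G₁.outer-type i
    ... | inj₂ j = G₂.outer-type j

    result : Ground (Γ ++ Δ)
    result = record
      { Node = G₁.Node ⊎ G₂.Node ; size = G₁.size + G₂.size
      ; nodes = ↔-trans +↔⊎ (G₁.nodes ⊎-↔ G₂.nodes)
      ; label = label ; target = target ; type = type
      ; typed = λ { (inj₁ v) → G₁.typed v ; (inj₂ v) → G₂.typed v }
      ; outer-type = λ i →
          trans (cong (λ j → type (from target (inj₂ j))) (sym (join-splitAt m n i)))
                (trans (outer-type (splitAt m i)) (sym (lookup-splitAt m Γ Δ i)))
      ; no-cycle = acyclic label target no-cycle
      }

  infixr 5 _∥_

  _∥_ : ProofStructure Γ → ProofStructure Δ → ProofStructure (Γ ++ Δ)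
  R ∥ S = ps (Juxtapose.result (ground R) (ground S)) λ where
    (inj₁ v) e → let open Content (content R v e) in boxContent body door principal-type auxiliary-type
    (inj₂ v) e → let open Content (content S v e) in boxContent body door principal-type auxiliary-type

  module Attach {m n : ℕ} (ℓ : Label) (Γ : Vec Formula m) (Θ : Vec Formula (#in ℓ))
                (Θ′ : Vec Formula (#out ℓ)) (Δ : Vec Formula n)
                (t : Typed ℓ (lookup Θ) (lookup Θ′)) (G₁ : Ground (Γ ++ Θ ++ Δ)) where

    module G₁ = Ground G₁

    label : G₁.Node ⊎ ⊤ → Label
    label = [ G₁.label , (λ _ → ℓ) ]′

    target : Arcs label ↔ Targets label (m + (#out ℓ + n))
    target = ↔-trans Σ-distribʳ-⊎
      (↔-trans (↔-trans G₁.target (↔-refl ⊎-↔ split₃ m (#in ℓ) n) ⊎-↔ Σ-⊤)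
      (↔-trans plug
      (↔-sym (↔-trans Σ-distribʳ-⊎ (↔-refl ⊎-↔ Σ-⊤)) ⊎-↔ ↔-sym (split₃ m (#out ℓ) n))))

    type : Arcs label → Formula
    type (inj₁ v , p) = G₁.type (v , p)
    type (inj₂ _ , p) = lookup Θ′ p

    step₁ : ∀ {v w} → _↝_ label target (inj₁ v) (inj₁ w) → _↝_ G₁.label G₁.target v w
    step₁ {v} (p , q , e) with to G₁.target (v , p) in eq
    step₁ {v} (p , q , refl) | inj₁ (u , r) = p , r , eq
    step₁ {v} (p , q , e) | inj₂ i with to (split₃ m (#in ℓ) n) i
    step₁ {v} (p , q , ()) | inj₂ i | inj₁ _
    step₁ {v} (p , q , ()) | inj₂ i | inj₂ (inj₁ _)
    step₁ {v} (p , q , ()) | inj₂ i | inj₂ (inj₂ _)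

    path₁ : ∀ {v w} → TransClosure (_↝_ label target) (inj₁ v) (inj₁ w) →
            TransClosure (_↝_ G₁.label G₁.target) v w
    path₁ [ s ]                     = [ step₁ s ]
    path₁ (_∷_ {y = inj₁ _} s ss) = step₁ s ∷ path₁ ss
    path₁ (_∷_ {y = inj₂ _} s [ _ , _ , () ])
    path₁ (_∷_ {y = inj₂ _} s ((_ , _ , ()) ∷ _))

    no-cycle : ∀ v → ¬ TransClosure (_↝_ label target) v v
    no-cycle (inj₁ v) c = acyclic↝ G₁.label G₁.target G₁.no-cycle v (path₁ c)
    no-cycle (inj₂ _) [ _ , _ , () ]
    no-cycle (inj₂ _) ((_ , _ , ()) ∷ _)

    old-type : ∀ s → G₁.type (G₁.outer (from (split₃ m (#in ℓ) n) s)) ≡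
               [ lookup Γ , [ lookup Θ , lookup Δ ]′ ]′ s
    old-type s = trans (G₁.outer-type _) (trans (lookup-split₃ Γ Θ Δ _)
      (cong [ lookup Γ , [ lookup Θ , lookup Δ ]′ ]′ (Inverse.strictlyInverseˡ (split₃ m (#in ℓ) n) s)))

    outer-type : ∀ i → type (from target (inj₂ i)) ≡ lookup (Γ ++ Θ′ ++ Δ) i
    outer-type i rewrite lookup-split₃ Γ Θ′ Δ i with to (split₃ m (#out ℓ) n) i
    ... | inj₁ j        = old-type (inj₁ j)
    ... | inj₂ (inj₁ p) = refl
    ... | inj₂ (inj₂ j) = old-type (inj₂ (inj₂ j))

    result : Ground (Γ ++ Θ′ ++ Δ)
    result = record
      { Node = G₁.Node ⊎ ⊤ ; size = G₁.size + 1
      ; nodes = ↔-trans +↔⊎ (G₁.nodes ⊎-↔ 1↔⊤)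
      ; label = label ; target = target ; type = type
      ; typed = λ { (inj₁ v) → G₁.typed v
                  ; (inj₂ _) → Typed-cong ℓ (λ p → sym (old-type (inj₂ (inj₁ p)))) (λ _ → refl) t }
      ; outer-type = outer-type
      ; no-cycle = acyclic label target no-cycle
      }

  -- Adds a node labelled ℓ below the conclusions Θ.
  attach : (ℓ : Label) (Γ : Vec Formula m) (Θ : Vec Formula (#in ℓ)) (Θ′ : Vec Formula (#out ℓ))
           (Δ : Vec Formula n) → (∀ k → ℓ ≢ box k) → Typed ℓ (lookup Θ) (lookup Θ′) →
           ProofStructure (Γ ++ Θ ++ Δ) → ProofStructure (Γ ++ Θ′ ++ Δ)
  attach ℓ Γ Θ Θ′ Δ no-box t R = ps (Attach.result ℓ Γ Θ Θ′ Δ t (ground R)) λ where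
    (inj₁ v) e → let open Content (content R v e) in boxContent body door principal-type auxiliary-type
    (inj₂ _) e → contradiction e (no-box _)

  regroup : ∀ {m k n} (Γ : Vec Formula m) (Θ : Vec Formula k) (Δ : Vec Formula n) →
            ProofStructure ((Γ ++ Θ) ++ Δ) → ProofStructure (Γ ++ Θ ++ Δ)
  regroup {m} {k} {n} Γ Θ Δ = reorder (cast-id (+-assoc m k n)) λ i →
    trans (cong (λ Ξ → lookup Ξ (Fin.cast (+-assoc m k n) i)) (sym (++-assoc-eqFree Γ Θ Δ)))
          (lookup-cast (+-assoc m k n) ((Γ ++ Θ) ++ Δ) i)

  -- The cyclic permutation moving the first of suc n elements to the end.
  rotate : ∀ n → Permutation (suc n) (n + 1)
  rotate n = ↔-trans (+↔⊎ {1} {n}) (↔-trans (⊎-comm _ _) (↔-sym +↔⊎))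

  rotate-first : ∀ (Γ : Vec Formula n) A → lookup (Γ ++ A ∷ []) (rotate n ⟨$⟩ʳ zero) ≡ A
  rotate-first Γ A = lookup-join Γ (A ∷ []) (inj₂ zero)

  rotate-other : ∀ (Γ : Vec Formula n) A i → lookup (Γ ++ A ∷ []) (rotate n ⟨$⟩ʳ suc i) ≡ lookup Γ i
  rotate-other Γ A i = lookup-join Γ (A ∷ []) (inj₁ i)

  boxed : ∀ (Γ : Vec Formula n) A → ProofStructure (map ⁇_ Γ ++ A ∷ []) →
          ProofStructure (map ⁇_ Γ ++ ! A ∷ [])
  boxed {n} Γ A R =
    reorder (rotate n) outer-type (ps single-box λ { _ refl → boxContent R (rotate n) first other })
    where
    single-box : Ground (! A ∷ map ⁇_ Γ)
    single-box = Single.result (box n) (! A ∷ map ⁇_ Γ) (λ ())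
                   λ _ → (A , refl) , λ j → lookup Γ j , lookup-map j ⁇_ Γ

    first : ! A ≡ ! lookup (map ⁇_ Γ ++ A ∷ []) (rotate n ⟨$⟩ʳ zero)
    first = cong !_ (sym (rotate-first (map ⁇_ Γ) A))

    other : ∀ j → lookup (map ⁇_ Γ) j ≡ lookup (map ⁇_ Γ ++ A ∷ []) (rotate n ⟨$⟩ʳ suc j)
    other j = sym (rotate-other (map ⁇_ Γ) A j)

    outer-type : ∀ i → lookup (map ⁇_ Γ ++ ! A ∷ []) (rotate n ⟨$⟩ʳ i) ≡ lookup (! A ∷ map ⁇_ Γ) i
    outer-type zero    = rotate-first (map ⁇_ Γ) (! A)
    outer-type (suc i) = rotate-other (map ⁇_ Γ) (! A) i

  infix 9 _°

  _° : Proof Γ → ProofStructure Γ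
  axiom A ° = single ax (A ∷ A ^⊥ ∷ []) (λ ()) (λ _ ()) λ _ → refl
  cut-rule {Γ = Γ} {A = A} {Δ = Δ} π π′ ° =
    attach cut Γ (A ∷ A ^⊥ ∷ []) [] Δ (λ _ ()) refl (regroup Γ (A ∷ []) (A ^⊥ ∷ Δ) (π ° ∥ π′ °))
  exchange σ σ-type π ° = reorder σ σ-type (π °)
  ⊗-rule {Γ = Γ} {A = A} {B = B} {Δ = Δ} π π′ ° =
    attach tensor Γ (A ∷ B ∷ []) (A ⊗ B ∷ []) Δ (λ _ ()) refl (regroup Γ (A ∷ []) (B ∷ Δ) (π ° ∥ π′ °))
  𝟏-rule ° = single one (𝟏 ∷ []) (λ ()) (λ _ ()) λ _ → refl
  ⅋-rule {Γ = Γ} {A = A} {B = B} π ° =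
    attach par Γ (A ∷ B ∷ []) (A ⅋ B ∷ []) [] (λ _ ()) refl (π °)
  ⊥-rule π ° = π ° ∥ single bot (⊥′ ∷ []) (λ ()) (λ _ ()) λ _ → refl
  dereliction {Γ = Γ} {A = A} π ° = attach der Γ (A ∷ []) (⁇ A ∷ []) [] (λ _ ()) refl (π °)
  weakening {A = A} π ° = π ° ∥ single wkn (⁇ A ∷ []) (λ ()) (λ _ ()) λ _ → A , refl
  contraction {Γ = Γ} {A = A} π ° =
    attach ctr Γ (⁇ A ∷ ⁇ A ∷ []) (⁇ A ∷ []) [] (λ _ ()) (A , refl , refl , refl) (π °)
  promotion {Γ = Γ} {A = A} π ° = boxed Γ A (π °)

  Sequentializable : Fragment → ProofStructure Γ → Set
  Sequentializable {Γ = Γ} ℱ R = Σ[ π ∈ Proof Γ ] AllSequentsIn ℱ π × π ° ≅ R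

{-# OPTIONS --safe #-}

-- Call a node labelled ax, 1, ⊗ or by a box a core node, and call a core node
-- a focus if none of its conclusions is a premise of a ⊗ node.  In a cut-free
-- polarized structure only core nodes have positive conclusions, and at most
-- one each.  Reversing the premises of ⊗ nodes orients every switching graph
-- so that every vertex has at most one incoming arc: the graph is a forest
-- with one tree per ⊥, ?w or focus node.  So ACC♯w just says that there is
-- exactly one focus, at every depth.
--
-- Given a unique focus, the core nodes form a tree of ⊗ nodes above it, which
-- is sequentialized first; the remaining nodes are then added in topological
-- order, each by a one-premise rule.  Conversely, in the structure of a proof
-- the ax, 1 and box nodes outnumber the ⊗ and cut nodes by exactly one, and
-- since every core node is either a focus or above one of the two premises of
-- a ⊗ node, in the cut-free case this number one counts the foci.

module Submission where

open import Defs
open import Data.Bool.Properties using (T-irrelevant)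
open import Data.Empty using (⊥; ⊥-elim)
open import Data.Fin.Base as Fin using (Fin; zero; suc; toℕ; _↑ˡ_; _↑ʳ_; splitAt)
open import Data.Fin.Induction using (spo-wellFounded; spo-noetherian)
open import Data.Fin.Patterns using (0F; 1F)
open import Data.Fin.Permutation using (↔⇒≡; Permutation; id; flip; _∘ₚ_; _⟨$⟩ʳ_; _⟨$⟩ˡ_; inverseʳ; inverseˡ; cast-id)
open import Data.Fin.Properties as Fin using (+↔⊎; *↔×; any?; 1↔⊤; splitAt-↑ˡ;
  splitAt-↑ʳ; toℕ-↑ˡ; toℕ-↑ʳ; toℕ-cast; toℕ-injective)
open import Data.List.Base as List using (List)
open import Data.List.Membership.Propositional using (_∈_)
import Data.List.Relation.Unary.All as ListAll
import Data.List.Relation.Unary.AllPairs as AllPairs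
open import Data.List.Relation.Unary.Any using (here; there)
open import Data.List.Relation.Unary.Unique.Propositional using (Unique)
open import Data.Nat.Base using (ℕ; zero; suc; _+_; _*_)
open import Data.Nat.Properties using (+-cancelˡ-≡; *-comm; +-identityʳ; +-cancelʳ-≡; +-assoc)
open import Data.Product using (Σ; Σ-syntax; ∃; ∃-syntax; _×_; _,_; proj₁; proj₂; ∃₂)
open import Data.Product.Function.Dependent.Propositional using (Σ-↔)
open import Data.Product.Function.NonDependent.Propositional using (_×-↔_)
open import Data.Sum as Sum using (_⊎_; inj₁; inj₂; [_,_]′)
open import Data.Sum.Algebra using (⊎-comm)
open import Data.Sum.Function.Propositional using (_⊎-↔_)
open import Data.Sum.Properties using (inj₁-injective; inj₂-injective)
open import Data.Unit.Base using (⊤; tt)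
open import Data.Vec.Base using (Vec; []; _∷_; tabulate; count; _++_; lookup; map)
open import Data.Vec.Properties using (lookup-map; lookup∘tabulate; ++-assoc-eqFree; lookup-cast)
open import Data.Vec.Relation.Unary.All using (All; []; _∷_)
open import Data.Vec.Relation.Unary.All.Properties using (lookup⁻; lookup⁺; ++⁺; ++ˡ⁻; ++ʳ⁻)
open import Function.Base as Function using (_∘_; _on_; case_of_)
open import Function.Bundles using (_↔_; _⇔_; Inverse; Equivalence; mk↔ₛ′; mk⇔)
open import Function.Properties.Inverse using (↔-refl; ↔-sym; ↔-trans; ↔⇒↣)
open import Function.Related.TypeIsomorphisms using (Σ-distribˡ-⊎; Σ-distribʳ-⊎)
open import Induction.WellFounded using (WellFounded; Acc; acc; wf⇒irrefl; module Subrelation)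
import Relation.Binary.Construct.Closure.Equivalence as EqC
open import Relation.Binary.Construct.Closure.ReflexiveTransitive using (Star; ε; _◅_; _◅◅_)
open import Relation.Binary.Construct.Closure.Transitive as Plus using (TransClosure; [_]; _∷_)
import Relation.Binary.Construct.On as On
open import Relation.Binary.Definitions using (DecidableEquality)
open import Relation.Binary.PropositionalEquality using (_≡_; _≢_; refl; sym; trans; cong;
  cong₂; subst; subst₂; isEquivalence; resp₂; subst-subst-sym; subst-sym-subst)
open import Relation.Binary.Structures using (IsStrictPartialOrder)
open import Relation.Nullary using (¬_; Dec; yes; no; contradiction)
open import Relation.Nullary.Decidable using (False; T?; _×-dec_; toWitnessFalse; fromWitnessFalse; map′; via-injection)
open import Relation.Unary using (Decidable; Irrelevant)

open Inverse using (to; from; strictlyInverseˡ; strictlyInverseʳ)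

-- That no vertex has two incoming arcs rests on two facts. Cuts being absent, a node other than ⊗
-- keeps at most one premise under a switching. A core node has premises only if it is a ⊗, and
-- these are reversed; so it is entered only along a conclusion of its own that leads into a ⊗, and
-- such a conclusion is positive, hence unique.
--
-- Acyclicity of the forest is not simply inherited from that of `R`, because the parent of a core
-- node lies below it in `R` and the parent of any other node lies above. A climb towards the root
-- goes up in `R` until it meets a core node and from there goes down through ⊗ nodes only. It
-- changes direction at most once, and both phases end in a finite acyclic graph.
--
-- Sequentialization grows a proof from the leaves downwards instead of removing terminal nodes. The
-- proof is kept together with an embedding of its structure into `R`, so that no part of `R` has to
-- be cut out and shown to satisfy the criterion again. The rules for ⊥ and ?w need a proof to act
-- on, which is why the core comes first.

Σ≡ : {A : Set} {P : A → Set} → Irrelevant P → {x y : Σ A P} → proj₁ x ≡ proj₁ y → x ≡ y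
Σ≡ irr {x , p} {_ , q} refl = cong (x ,_) (irr p q)

-- Irrelevance of `P` makes a pair depend on its index alone. This turns the number in `#w`, and any
-- other count, into a bijection, so that cardinalities can be compared with `↔⇒≡`.
count↔Σ : {A : Set} {P : A → Set} (P? : Decidable P) → Irrelevant P →
          ∀ {n} (f : Fin n → A) → Fin (count P? (tabulate f)) ↔ (Σ[ i ∈ Fin n ] P (f i))
count↔Σ P? irr {zero}  f = mk↔ₛ′ (λ ()) (λ ()) (λ ()) (λ ())
count↔Σ {P = P} P? irr {suc n} f with P? (f zero) | count↔Σ P? irr (f ∘ suc)
... | yes p | rest = mk↔ₛ′
  (λ { zero → zero , p ; (suc i) → suc (proj₁ (to rest i)) , proj₂ (to rest i) })
  (λ { (zero , _) → zero ; (suc i , q) → suc (from rest (i , q)) })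
  (λ { (zero , q) → cong (zero ,_) (irr p q)
     ; (suc i , q) → cong (λ (j , r) → suc j , r) (strictlyInverseˡ rest (i , q)) })
  (λ { zero → refl ; (suc i) → cong suc (strictlyInverseʳ rest i) })
... | no ¬p | rest = mk↔ₛ′
  (λ i → suc (proj₁ (to rest i)) , proj₂ (to rest i))
  (λ { (zero , p) → ⊥-elim (¬p p) ; (suc i , q) → from rest (i , q) })
  (λ { (zero , p) → ⊥-elim (¬p p)
     ; (suc i , q) → cong (λ (j , r) → suc j , r) (strictlyInverseˡ rest (i , q)) })
  (strictlyInverseʳ rest)

-- The transitive closure of an acyclic relation is a strict order, and strict orders on `Fin n` are
-- well-founded in both directions. Both are needed: the forest is climbed against `↝` outside the
-- core and along `↝` inside it.
module FiniteAcyclic {A : Set} {n : ℕ} (enumeration : Fin n ↔ A) {_∼_ : A → A → Set}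
                     (irrefl : ∀ x → ¬ TransClosure _∼_ x x) where

  private
    _⊏_ : Fin n → Fin n → Set
    _⊏_ = TransClosure _∼_ on to enumeration

    transport : ∀ {x y} → TransClosure _∼_ x y → (_⊏_ on from enumeration) x y
    transport = subst₂ (TransClosure _∼_) (sym (strictlyInverseˡ enumeration _))
                       (sym (strictlyInverseˡ enumeration _))

    isSPO : IsStrictPartialOrder _≡_ _⊏_
    isSPO = record
      { isEquivalence = isEquivalence
      ; irrefl        = λ { refl → irrefl _ }
      ; trans         = Plus.transitive _∼_
      ; <-resp-≈      = resp₂ _⊏_
      }

  wellFounded : WellFounded (TransClosure _∼_)
  wellFounded = Subrelation.wellFounded transport (On.wellFounded (from enumeration) (spo-wellFounded isSPO))

  noetherian : WellFounded (Function.flip (TransClosure _∼_))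
  noetherian = Subrelation.wellFounded (λ {x} {y} → transport {y} {x})
                 (On.wellFounded (from enumeration) (spo-noetherian isSPO))

-- Forests obtained by reorienting the arcs of a digraph.

module OrientedForest (D : Digraph) {Root : Set} (rep : Root → Digraph.Vertex D)
  (child parent    : Digraph.Arc D → Digraph.Vertex D)
  (joins           : ∀ a → Digraph.Joins D a (parent a) (child a))
  (child-injective : ∀ {a b} → child a ≡ child b → a ≡ b)
  (rep-injective   : ∀ {r s} → rep r ≡ rep s → r ≡ s)
  (root-no-child   : ∀ r a → child a ≢ rep r)
  (child-or-root   : ∀ x → (∃[ a ] x ≡ child a) ⊎ (∃[ r ] x ≡ rep r))
  where

  open Digraph D

  infix 4 _≺_ _⇝_

  _≺_ : Vertex → Vertex → Set
  x ≺ y = ∃[ a ] x ≡ parent a × y ≡ child a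

  data _⇝_ (x : Vertex) (r : Root) : Set where
    root : x ≡ rep r → x ⇝ r
    up   : ∀ a → x ≡ child a → parent a ⇝ r → x ⇝ r

  -- The climb is forced: `child-injective` leaves one arc above a vertex, and `root-no-child` none
  -- above a root.
  ⇝-functional : ∀ {x r s} → x ⇝ r → x ⇝ s → r ≡ s
  ⇝-functional (root e)   (root e′)    = rep-injective (trans (sym e) e′)
  ⇝-functional (root e)   (up a e′ _)  = contradiction (trans (sym e′) e) (root-no-child _ a)
  ⇝-functional (up a e _) (root e′)    = contradiction (trans (sym e) e′) (root-no-child _ a)
  ⇝-functional (up a e t) (up b e′ t′) with child-injective (trans (sym e) e′)
  ... | refl = ⇝-functional t t′

  connect : ∀ a → Connected (child a) (parent a)
  connect a with joins a
  ... | inj₁ (t , h) = EqC.symmetric _ (EqC.return (a , t , h))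
  ... | inj₂ (t , h) = EqC.return (a , t , h)

  ⇝⇒connected : ∀ {x r} → x ⇝ r → Connected x (rep r)
  ⇝⇒connected (root refl)   = EqC.reflexive _
  ⇝⇒connected (up a refl t) = EqC.transitive _ (connect a) (⇝⇒connected t)

  module _ (≺-wellFounded : WellFounded _≺_) where

    ascend : ∀ {x} → Acc _≺_ x → ∃ (x ⇝_)
    ascend {x} (acc rec) with child-or-root x
    ... | inj₁ (a , e) = let r , t = ascend (rec (a , refl , e)) in r , up a e t
    ... | inj₂ (r , e) = r , root e

    rootOf : Vertex → Root
    rootOf x = proj₁ (ascend (≺-wellFounded x))

    ⇝-rootOf : ∀ x → x ⇝ rootOf x
    ⇝-rootOf x = proj₂ (ascend (≺-wellFounded x))

    rootOf-unique : ∀ {x r} → x ⇝ r → rootOf x ≡ r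
    rootOf-unique = ⇝-functional (⇝-rootOf _)

    rootOf-rep : ∀ r → rootOf (rep r) ≡ r
    rootOf-rep r = rootOf-unique (root refl)

    rootOf-child : ∀ a → rootOf (child a) ≡ rootOf (parent a)
    rootOf-child a = rootOf-unique (up a refl (⇝-rootOf (parent a)))

    rootOf-arc : ∀ a → rootOf (tail a) ≡ rootOf (head a)
    rootOf-arc a with joins a
    ... | inj₁ (t , h) = trans (cong rootOf t) (trans (sym (rootOf-child a)) (cong rootOf (sym h)))
    ... | inj₂ (t , h) = trans (cong rootOf t) (trans (rootOf-child a) (cong rootOf (sym h)))

    rootOf-connected : ∀ {x y} → Connected x y → rootOf x ≡ rootOf y
    rootOf-connected = EqC.fold (On.isEquivalence rootOf isEquivalence) λ { (a , refl , refl) → rootOf-arc a }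

    connected-rootOf : ∀ {x y} → rootOf x ≡ rootOf y → Connected x y
    connected-rootOf {x} {y} e = EqC.transitive _ (⇝⇒connected (subst (x ⇝_) e (⇝-rootOf x)))
                                   (EqC.symmetric _ (⇝⇒connected (⇝-rootOf y)))

    -- The root is constant along arcs and every vertex is connected to its root, so the roots
    -- represent each component exactly once.
    components⇒roots : ∀ {c} → HasComponents c → Fin c ↔ Root
    components⇒roots H = mk↔ₛ′ (λ i → rootOf (proj₁ (surjective i))) (component ∘ rep) root-component component-root
      where
      open HasComponents H
      root-component : ∀ r → rootOf (proj₁ (surjective (component (rep r)))) ≡ r
      root-component r = trans (rootOf-connected (Equivalence.from (classifies _ _) (proj₂ (surjective _) refl)))
                         (rootOf-rep r)
      component-root : ∀ i → component (rep (rootOf (proj₁ (surjective i)))) ≡ i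
      component-root i = trans (sym (Equivalence.to (classifies _ _) (⇝⇒connected (⇝-rootOf _))))
                         (proj₂ (surjective i) refl)

    roots⇒components : ∀ {c} → Fin c ↔ Root → HasComponents c
    roots⇒components I = record
      { component  = from I ∘ rootOf
      ; surjective = λ i → rep (to I i) , λ { refl → trans (cong (from I) (rootOf-rep _)) (strictlyInverseʳ I i) }
      ; classifies = λ x y → mk⇔ (cong (from I) ∘ rootOf-connected)
          λ e → connected-rootOf (trans (sym (strictlyInverseˡ I _)) (trans (cong (to I) e) (strictlyInverseˡ I _)))
      }

    descends-or-climbs : ∀ {x y} a → Joins a x y →
                         (x ≡ parent a × y ≡ child a) ⊎ (x ≡ child a × y ≡ parent a)
    descends-or-climbs a j with j | joins a
    ... | inj₁ (refl , refl) | inj₁ e       = inj₁ e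
    ... | inj₁ (refl , refl) | inj₂ e       = inj₂ e
    ... | inj₂ (refl , refl) | inj₁ (p , c) = inj₂ (c , p)
    ... | inj₂ (refl , refl) | inj₂ (c , p) = inj₁ (p , c)

    -- The arc above a vertex is unique, so a walk without repeated arcs
    -- cannot climb again after having descended.
    descend : ∀ {x y} (w : Walk x y) b → Unique (b List.∷ arcs w) → x ≡ child b →
              Star _≺_ x y × ∃[ c ] c ∈ b List.∷ arcs w × y ≡ child c
    descend []           b _ e = ε , b , here refl , e
    descend (step a j w) b ((b≢a ListAll.∷ _) AllPairs.∷ u) e with descends-or-climbs a j
    ... | inj₂ (c , _) = contradiction (child-injective (trans (sym e) c)) b≢a
    ... | inj₁ (p , c) = let s , d , d∈ , q = descend w a u c in (a , p , c) ◅ s , d , there d∈ , q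

    -- Here `a` is an arc that has just been climbed. If the rest of the walk ever descended,
    -- `descend` would make it end at the child of one of its own arcs; since it ends at `child a`,
    -- that arc would be `a`, which must not be repeated. So the walk only climbs.
    climb : ∀ {y z} (w : Walk y z) a → Unique (a List.∷ arcs w) → z ≡ child a → Star _≺_ z y
    climb []           a _ _ = ε
    climb (step b j w) a (a∉@(_ ListAll.∷ a∉w) AllPairs.∷ u@(_ AllPairs.∷ u′)) e with descends-or-climbs b j
    ... | inj₂ (c , p) = climb w a (a∉w AllPairs.∷ u′) e ◅◅ (b , p , c) ◅ ε
    ... | inj₁ (_ , c) with descend w b u c
    ... | _ , d , d∈ , e′ = contradiction (child-injective (trans (sym e) e′)) (ListAll.lookup a∉ d∈)

    ≺⁺-irrefl : ∀ {x} → ¬ TransClosure _≺_ x x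
    ≺⁺-irrefl = wf⇒irrefl (resp₂ _) sym (Plus.wellFounded _ ≺-wellFounded) refl

    ◅⁺ : ∀ {x y z} → x ≺ y → Star _≺_ y z → TransClosure _≺_ x z
    ◅⁺ s ε        = [ s ]
    ◅⁺ s (t ◅ ts) = s ∷ ◅⁺ t ts

    -- The direction of the first arc decides that of the whole cycle, which is therefore a cycle of
    -- `≺` read in one direction or the other.
    no-undirected-cycle : ¬ UndirectedCycle
    no-undirected-cycle record { walk = [] ; nonempty = ne } = ne refl
    no-undirected-cycle record { walk = step a j w ; unique-arcs = u } with descends-or-climbs a j
    ... | inj₁ (p , c) = ≺⁺-irrefl (◅⁺ (a , p , c) (proj₁ (descend w a u c)))
    ... | inj₂ (c , p) = ≺⁺-irrefl (◅⁺ (a , p , c) (climb w a u c))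

-- Classification of the labels.

data Core : Label → Set where
  ax     : Core ax
  one    : Core one
  tensor : Core tensor
  box    : ∀ {k} → Core (box k)

core? : Decidable Core
core? ax      = yes ax
core? cut     = no λ ()
core? one     = yes one
core? bot     = no λ ()
core? tensor  = yes tensor
core? par     = no λ ()
core? der     = no λ ()
core? wkn     = no λ ()
core? ctr     = no λ ()
core? (box k) = yes box

core-irrelevant : Irrelevant Core
core-irrelevant ax     ax     = refl
core-irrelevant one    one    = refl
core-irrelevant tensor tensor = refl
core-irrelevant box    box    = refl

weakening-irrelevant : Irrelevant Weakening
weakening-irrelevant bot bot = refl
weakening-irrelevant wkn wkn = refl

switched-irrelevant : Irrelevant Switched
switched-irrelevant par par = refl
switched-irrelevant ctr ctr = refl

tensor? : (ℓ : Label) → Dec (ℓ ≡ tensor)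
tensor? ax      = no λ ()
tensor? cut     = no λ ()
tensor? one     = no λ ()
tensor? bot     = no λ ()
tensor? tensor  = yes refl
tensor? par     = no λ ()
tensor? der     = no λ ()
tensor? wkn     = no λ ()
tensor? ctr     = no λ ()
tensor? (box k) = no λ ()

≡-irrelevant : {A : Set} {x : A} → Irrelevant (_≡ x)
≡-irrelevant refl refl = refl

core-premise : ∀ {ℓ} → Core ℓ → Fin (#in ℓ) → ℓ ≡ tensor
core-premise tensor _ = refl

weakening-premise : ∀ {ℓ} → Weakening ℓ → ¬ Fin (#in ℓ)
weakening-premise bot ()
weakening-premise wkn ()

weakening-core : ∀ {ℓ} → Weakening ℓ → ¬ Core ℓ
weakening-core bot ()
weakening-core wkn ()

switched-core : ∀ {ℓ} → Switched ℓ → ¬ Core ℓ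
switched-core par ()
switched-core ctr ()

opposite : ∀ {ℓ} → Switched ℓ → Fin (#in ℓ) → Fin (#in ℓ)
opposite par = Fin.opposite
opposite ctr = Fin.opposite

opposite-≢ : ∀ {ℓ} (s : Switched ℓ) p → p ≢ opposite s p
opposite-≢ par 0F ()
opposite-≢ par 1F ()
opposite-≢ ctr 0F ()
opposite-≢ ctr 1F ()

≢-≢⇒≡ : ∀ {p q r : Fin 2} → p ≢ q → p ≢ r → q ≡ r
≢-≢⇒≡ {0F} {0F} {_}  h _ = contradiction refl h
≢-≢⇒≡ {0F} {1F} {0F} _ h = contradiction refl h
≢-≢⇒≡ {0F} {1F} {1F} _ _ = refl
≢-≢⇒≡ {1F} {1F} {_}  h _ = contradiction refl h
≢-≢⇒≡ {1F} {0F} {1F} _ h = contradiction refl h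
≢-≢⇒≡ {1F} {0F} {0F} _ _ = refl

redirected-unique : ∀ {ℓ} → Switched ℓ → {p q r : Fin (#in ℓ)} → p ≢ q → p ≢ r → q ≡ r
redirected-unique par = ≢-≢⇒≡
redirected-unique ctr = ≢-≢⇒≡

-- Apart from `cut` and `tensor` only switched labels have two premises, and there `f` names the one
-- that is kept. For the other labels both equations are vacuous, but at most one premise exists.
kept-unique : ∀ ℓ {f : Switched ℓ → Fin (#in ℓ)} {p q} → ℓ ≢ cut → ℓ ≢ tensor →
              (∀ s → f s ≡ p) → (∀ s → f s ≡ q) → p ≡ q
kept-unique cut             h _ _ _ = contradiction refl h
kept-unique tensor          _ h _ _ = contradiction refl h
kept-unique par             _ _ e d = trans (sym (e par)) (d par)
kept-unique ctr             _ _ e d = trans (sym (e ctr)) (d ctr)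
kept-unique der {_} {0F} {0F} _ _ _ _ = refl

data Shape : Label → Set where
  core      : ∀ {ℓ} → Core ℓ → Shape ℓ
  weakening : ∀ {ℓ} → Weakening ℓ → Shape ℓ
  switched  : ∀ {ℓ} → Switched ℓ → Shape ℓ
  der       : ∀ {ℓ} → ℓ ≡ der → Shape ℓ

shape : ∀ ℓ → ℓ ≢ cut → Shape ℓ
shape ax      _ = core ax
shape cut     h = contradiction refl h
shape one     _ = core one
shape bot     _ = weakening bot
shape tensor  _ = core tensor
shape par     _ = switched par
shape der     _ = der refl
shape wkn     _ = weakening wkn
shape ctr     _ = switched ctr
shape (box k) _ = core box

-- Leaves outnumber junctions by one.

data Leaf : Label → Set where
  ax  : Leaf ax
  one : Leaf one
  box : ∀ {k} → Leaf (box k)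

data Junction : Label → Set where
  tensor : Junction tensor
  cut    : Junction cut

leaf? : Decidable Leaf
leaf? ax      = yes ax
leaf? cut     = no λ ()
leaf? one     = yes one
leaf? bot     = no λ ()
leaf? tensor  = no λ ()
leaf? par     = no λ ()
leaf? der     = no λ ()
leaf? wkn     = no λ ()
leaf? ctr     = no λ ()
leaf? (box k) = yes box

leaf-irrelevant : Irrelevant Leaf
leaf-irrelevant ax  ax  = refl
leaf-irrelevant one one = refl
leaf-irrelevant box box = refl

junction-irrelevant : Irrelevant Junction
junction-irrelevant tensor tensor = refl
junction-irrelevant cut    cut    = refl

leaf-junction : ∀ {ℓ} → Leaf ℓ → ¬ Junction ℓ
leaf-junction ax  ()
leaf-junction one ()
leaf-junction box ()

leaf⊎tensor↔core : ∀ {ℓ} → (Leaf ℓ ⊎ ℓ ≡ tensor) ↔ Core ℓ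
leaf⊎tensor↔core = mk↔ₛ′
  (λ { (inj₁ ax) → ax ; (inj₁ one) → one ; (inj₁ box) → box ; (inj₂ refl) → tensor })
  (λ { ax → inj₁ ax ; one → inj₁ one ; box → inj₁ box ; tensor → inj₂ refl })
  (λ { ax → refl ; one → refl ; box → refl ; tensor → refl })
  (λ { (inj₁ ax) → refl ; (inj₁ one) → refl ; (inj₁ box) → refl ; (inj₂ refl) → refl })

tensor↔junction : ∀ {ℓ} → ℓ ≢ cut → (ℓ ≡ tensor) ↔ Junction ℓ
tensor↔junction h = mk↔ₛ′ (λ { refl → tensor }) (λ { tensor → refl ; cut → contradiction refl h })
                          (λ { tensor → refl ; cut → contradiction refl h }) λ { refl → refl }

Balanced : {Node : Set} → (Node → Label) → Set
Balanced label = Σ _ (Leaf ∘ label) ↔ (⊤ ⊎ Σ _ (Junction ∘ label))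

leaf-balanced : ∀ {ℓ} → Leaf ℓ → Balanced {⊤} (λ _ → ℓ)
leaf-balanced l = mk↔ₛ′ (λ _ → inj₁ tt) (λ _ → tt , l)
  (λ { (inj₁ _) → refl ; (inj₂ (_ , j)) → contradiction j (leaf-junction l) })
  (λ _ → Σ≡ leaf-irrelevant refl)

module _ {Node : Set} {label : Node → Label} {ℓ : Label} where

  Σ-extend : (P : Label → Set) → Σ (Node ⊎ ⊤) (P ∘ [ label , (λ _ → ℓ) ]′) ↔ (Σ Node (P ∘ label) ⊎ P ℓ)
  Σ-extend P = ↔-trans Σ-distribʳ-⊎ (↔-refl ⊎-↔ Σ-⊤)

  Σ-extend-empty : (P : Label → Set) → ¬ P ℓ → Σ (Node ⊎ ⊤) (P ∘ [ label , (λ _ → ℓ) ]′) ↔ Σ Node (P ∘ label)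
  Σ-extend-empty P ¬p = ↔-trans (Σ-extend P) (⊎-identityʳ′ ¬p)

  neutral-balanced : ¬ Leaf ℓ → ¬ Junction ℓ → Balanced label → Balanced [ label , (λ _ → ℓ) ]′
  neutral-balanced ¬l ¬j b = 
    ↔-trans (Σ-extend-empty Leaf ¬l) (↔-trans b (↔-refl ⊎-↔ ↔-sym (Σ-extend-empty Junction ¬j)))

junction-balanced : {Node Node′ : Set} {label : Node → Label} {label′ : Node′ → Label} {ℓ : Label} → Junction ℓ →
                    Balanced label → Balanced label′ → Balanced [ [ label , label′ ]′ , (λ _ → ℓ) ]′
junction-balanced {label = label} {label′} {ℓ} j b b′ =
  ↔-trans (Σ-extend-empty {label = label₁₂} {ℓ} Leaf λ l → leaf-junction l j)
  (↔-trans Σ-distribʳ-⊎ (↔-trans (b ⊎-↔ b′)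
  (↔-trans collect (↔-refl ⊎-↔ ↔-sym (↔-trans (Σ-extend {label = label₁₂} {ℓ} Junction) (Σ-distribʳ-⊎ ⊎-↔ ⊤↔))))))
  where
  label₁₂ = [ label , label′ ]′
  -- Of the two spare units the left one stays spare, and the right one is matched with the new
  -- junction.
  collect : {A B : Set} → ((⊤ ⊎ A) ⊎ (⊤ ⊎ B)) ↔ (⊤ ⊎ ((A ⊎ B) ⊎ ⊤))
  collect = mk↔ₛ′
    (λ { (inj₁ (inj₁ _)) → inj₁ tt ; (inj₁ (inj₂ a)) → inj₂ (inj₁ (inj₁ a))
       ; (inj₂ (inj₁ _)) → inj₂ (inj₂ tt) ; (inj₂ (inj₂ b)) → inj₂ (inj₁ (inj₂ b)) })
    (λ { (inj₁ _) → inj₁ (inj₁ tt) ; (inj₂ (inj₁ (inj₁ a))) → inj₁ (inj₂ a)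
       ; (inj₂ (inj₂ _)) → inj₂ (inj₁ tt) ; (inj₂ (inj₁ (inj₂ b))) → inj₂ (inj₂ b) })
    (λ { (inj₁ _) → refl ; (inj₂ (inj₁ (inj₁ a))) → refl ; (inj₂ (inj₂ _)) → refl ; (inj₂ (inj₁ (inj₂ b))) → refl })
    (λ { (inj₁ (inj₁ _)) → refl ; (inj₁ (inj₂ a)) → refl ; (inj₂ (inj₁ _)) → refl ; (inj₂ (inj₂ b)) → refl })
  ⊤↔ : Junction _ ↔ ⊤
  ⊤↔ = mk↔ₛ′ (λ _ → tt) (λ _ → j) (λ _ → refl) (λ _ → junction-irrelevant _ _)

toℕ-subst : ∀ {k l} (f : Label → ℕ) (e : k ≡ l) (p : Fin (f k)) → toℕ (subst (Fin ∘ f) e p) ≡ toℕ p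
toℕ-subst f refl p = refl

bijection : {A B : Set} (f : A → B) → (∀ {x y} → f x ≡ f y → x ≡ y) → (∀ y → ∃[ x ] f x ≡ y) → A ↔ B
bijection f inj surj = mk↔ₛ′ f (proj₁ ∘ surj) (proj₂ ∘ surj) (λ x → inj (proj₂ (surj (f x))))

-- Splits positions into those chosen by `f`, in the order of `f`, and the rest; the exchanges that
-- bring the premises of a node to one end of a sequent come from it. The complement is cut out with
-- `False`, which is irrelevant and so can be counted.
separate : ∀ {k m} (f : Fin k → Fin m) → (∀ {p q} → f p ≡ f q → p ≡ q) →
           ∃[ c ] Σ[ ψ ∈ Fin m ↔ (Fin c ⊎ Fin k) ] (∀ q → from ψ (inj₂ q) ≡ f q)
separate {k} {m} f inj =
  _ , ↔-sym (↔-trans (count↔Σ (λ i → T? _) T-irrelevant (λ i → i) ⊎-↔ ↔-refl) (bijection g g-injective g-surjective)) ,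
  λ _ → refl
  where
  hit? : ∀ i → Dec (∃[ q ] f q ≡ i)
  hit? i = any? λ q → f q Fin.≟ i
  g : Σ (Fin m) (λ i → False (hit? i)) ⊎ Fin k → Fin m
  g (inj₁ (i , _)) = i
  g (inj₂ q)       = f q
  g-injective : ∀ {x y} → g x ≡ g y → x ≡ y
  g-injective {inj₁ _} {inj₁ _} e = cong inj₁ (Σ≡ T-irrelevant e)
  g-injective {inj₁ (_ , h)} {inj₂ q} e = contradiction (q , sym e) (toWitnessFalse h)
  g-injective {inj₂ q} {inj₁ (_ , h)} e = contradiction (q , e) (toWitnessFalse h)
  g-injective {inj₂ _} {inj₂ _} e = cong inj₂ (inj e)
  g-surjective : ∀ i → ∃[ x ] g x ≡ i
  g-surjective i with hit? i
  ... | yes (q , e) = inj₂ q , e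
  ... | no ¬h = inj₁ (i , fromWitnessFalse ¬h) , refl

subst-subst-syms : ∀ {A : Set} {F : A → Set} {x y z : A} (e : x ≡ y) (d : y ≡ z) (p : F z) →
                   subst F (sym e) (subst F (sym d) p) ≡ subst F (sym (trans e d)) p
subst-subst-syms refl refl p = refl

unsnoc : {A : Set} {_∼_ : A → A → Set} → ∀ {x z} → Star _∼_ x z → x ≡ z ⊎ ∃[ y ] Star _∼_ x y × y ∼ z
unsnoc ε = inj₁ refl
unsnoc (s ◅ ss) with unsnoc ss
... | inj₁ refl         = inj₂ (_ , ε , s)
... | inj₂ (y , t , s′) = inj₂ (y , s ◅ t , s′)

-- The shorter of two paths from one source is a prefix of the longer. Applied below to a node that
-- would lie above both premises of a ⊗.
deterministic-linear : {A : Set} {_∼_ : A → A → Set} → (∀ {x y z} → x ∼ y → x ∼ z → y ≡ z) →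
                       ∀ {x y z} → Star _∼_ x y → Star _∼_ x z → Star _∼_ y z ⊎ Star _∼_ z y
deterministic-linear det ε        t        = inj₁ t
deterministic-linear det (s ◅ ss) ε        = inj₂ (s ◅ ss)
deterministic-linear det (s ◅ ss) (t ◅ ts) with det s t
... | refl = deterministic-linear det ss ts

module _ (𝒜 : Atoms) where

  open MELL 𝒜
  open ProofStructure
  open Everywhere

  private
    variable
      c k m n : ℕ
      Γ Δ : Vec Formula m
      Δ′ : Vec Formula n

  -- Polarity of the conclusions of a node.

  positive-dual : ∀ {A} → Positive A → ¬ Positive (A ^⊥)
  positive-dual 𝟏         ()
  positive-dual (!atom X) ()
  positive-dual (! _)     ()
  positive-dual (_ ⊗ _)   ()

  tensor-premise-positive : ∀ {ℓ} {i : Fin (#in ℓ) → Formula} {o} → Typed ℓ i o → ℓ ≡ tensor →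
                            (∀ p → Polarized (o p)) → ∀ q → Positive (i q)
  tensor-premise-positive {o = o} t refl h q with o 0F | t | h 0F
  tensor-premise-positive t refl h 0F | _ | refl | pos (P ⊗ Q) = P
  tensor-premise-positive t refl h 1F | _ | refl | pos (P ⊗ Q) = Q

  positive-core : ∀ ℓ {i : Fin (#in ℓ) → Formula} {o} → Typed ℓ i o → ∀ {p} → Positive (o p) → Core ℓ
  positive-core ax      _ _ = ax
  positive-core one     _ _ = one
  positive-core tensor  _ _ = tensor
  positive-core (box k) _ _ = box
  positive-core bot {o = o} t {0F} P with o 0F | t | P
  ... | _ | refl | ()
  positive-core par {o = o} t {0F} P with o 0F | t | P
  ... | _ | refl | ()
  positive-core der {o = o} t {0F} P with o 0F | t | P
  ... | _ | refl | ()
  positive-core wkn {o = o} t {0F} P with o 0F | t | P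
  ... | _ | _ , refl | ()
  positive-core ctr {o = o} t {0F} P with o 0F | t | P
  ... | _ | _ , refl , _ | ()

  -- For `ax` the two conclusions are dual, and the dual of a positive formula is not positive; for
  -- a box the auxiliary conclusions are of the form `⁇ C`.
  positive-unique : ∀ ℓ {i : Fin (#in ℓ) → Formula} {o} → Typed ℓ i o →
                    ∀ {p q} → Positive (o p) → Positive (o q) → p ≡ q
  positive-unique ax      t {0F} {0F} _ _ = refl
  positive-unique ax      t {1F} {1F} _ _ = refl
  positive-unique ax      t {0F} {1F} P Q = contradiction (subst Positive t Q) (positive-dual P)
  positive-unique ax      t {1F} {0F} P Q = contradiction (subst Positive t P) (positive-dual Q)
  positive-unique one     t {0F} {0F} _ _ = refl
  positive-unique bot     t {0F} {0F} _ _ = refl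
  positive-unique tensor  t {0F} {0F} _ _ = refl
  positive-unique par     t {0F} {0F} _ _ = refl
  positive-unique der     t {0F} {0F} _ _ = refl
  positive-unique wkn     t {0F} {0F} _ _ = refl
  positive-unique ctr     t {0F} {0F} _ _ = refl
  positive-unique (box k) t       {zero}  {zero}  _ _ = refl
  positive-unique (box k) (_ , t) {suc p} {_}     P _ with subst Positive (proj₂ (t p)) P
  ... | ()
  positive-unique (box k) (_ , t) {zero}  {suc q} _ Q with subst Positive (proj₂ (t q)) Q
  ... | ()

  -- Foci, and well-foundedness of ground structures.

  module _ {n : ℕ} {Γ : Vec Formula n} (G : Ground Γ) where

    open Ground G

    IntoTensor : Targets label n → Set
    IntoTensor (inj₁ (w , _)) = label w ≡ tensor
    IntoTensor (inj₂ _)       = ⊥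

    intoTensor? : Decidable IntoTensor
    intoTensor? (inj₁ (w , _)) = tensor? (label w)
    intoTensor? (inj₂ _)       = no λ ()

    feedsTensor? : ∀ v → Dec (∃[ p ] IntoTensor (to target (v , p)))
    feedsTensor? v = any? λ p → intoTensor? (to target (v , p))

    -- Absence of a tensor below is stated with False, a proposition even
    -- without function extensionality, so that foci can be counted.
    Focus : Node → Set
    Focus v = Core (label v) × False (feedsTensor? v)

    focus-irrelevant : Irrelevant Focus
    focus-irrelevant (c , f) (c′ , f′) with core-irrelevant c c′ | T-irrelevant f f′
    ... | refl | refl = refl

    Foci : Set
    Foci = Σ Node Focus

    target-premise : ∀ v p → to target (premise v p) ≡ inj₁ (v , p)
    target-premise v p = strictlyInverseˡ target _

    premise-target : ∀ {a v p} → to target a ≡ inj₁ (v , p) → a ≡ premise v p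
    premise-target {a} e = trans (sym (strictlyInverseʳ target a)) (cong (from target) e)

    target-injective : ∀ {a b} → to target a ≡ to target b → a ≡ b
    target-injective {a} {b} e =
      trans (sym (strictlyInverseʳ target a)) (trans (cong (from target) e) (strictlyInverseʳ target b))

    ↝-acyclic : ∀ v → ¬ TransClosure (_↝_ label target) v v
    ↝-acyclic = acyclic↝ label target no-cycle

    private module A = FiniteAcyclic nodes ↝-acyclic

    ↝-wellFounded : WellFounded (_↝_ label target)
    ↝-wellFounded = Subrelation.wellFounded [_] A.wellFounded

    ↝-noetherian : WellFounded (Function.flip (_↝_ label target))
    ↝-noetherian = Subrelation.wellFounded [_] A.noetherian

  finite-subset : {n : ℕ} {Γ : Vec Formula n} (G : Ground Γ) {P : Ground.Node G → Set} →
                  Decidable P → Irrelevant P → ∃[ c ] (Fin c ↔ Σ (Ground.Node G) P)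
  finite-subset G P? irr =
    _ , ↔-trans (count↔Σ P? irr (to nodes)) (Σ-↔ nodes ↔-refl)
    where open Ground G

  -- Switching graphs as forests rooted at weakenings and foci.

  module CutFreePolarized {n : ℕ} {Γ : Vec Formula n} (G : Ground Γ) (cut-free : ∀ v → Ground.label G v ≢ cut)
                          (polarized : ∀ a → Polarized (Ground.type G a)) where

    open Ground G

    tensor-positive : ∀ {a} → IntoTensor G (to target a) → Positive (type a)
    tensor-positive {a} t with to target a in eq
    ... | inj₁ (w , q) = subst (Positive ∘ type) (sym (premise-target G eq))
                           (tensor-premise-positive (typed w) t (λ p → polarized (w , p)) q)

    tensor-core : ∀ {v p} → IntoTensor G (to target (v , p)) → Core (label v)
    tensor-core {v} t = positive-core (label v) (typed v) (tensor-positive t)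

    tensor-unique : ∀ {v p q} → IntoTensor G (to target (v , p)) → IntoTensor G (to target (v , q)) → p ≡ q
    tensor-unique {v} t t′ = positive-unique (label v) (typed v) (tensor-positive t) (tensor-positive t′)

    module _ (φ : Switching G) where

      open Digraph (switchingGraph G φ) using () renaming
        (Vertex to Vertexᵠ; head to headᵠ; tail to tailᵠ; Joins to Joinsᵠ;
         UndirectedCycle to UndirectedCycleᵠ; HasComponents to HasComponentsᵠ)

      redirect-node : ∀ t {v} → redirect G φ t ≡ inj₁ (inj₁ v) → ∃[ p ] t ≡ inj₁ (v , p) × (∀ s → φ v s ≡ p)
      redirect-node (inj₁ (v , p)) e with switched? (label v)
      redirect-node (inj₁ (v , p)) refl | no ¬s = p , refl , λ s → contradiction s ¬s
      ... | yes s with φ v s Fin.≟ p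
      redirect-node (inj₁ (v , p)) refl | yes s | yes e =
        p , refl , λ s′ → subst (λ s → φ v s ≡ p) (switched-irrelevant s s′) e

      redirect-fresh : ∀ t {v s} → redirect G φ t ≡ inj₂ (v , s) → ∃[ p ] t ≡ inj₁ (v , p) × φ v s ≢ p
      redirect-fresh (inj₁ (v , p)) e with switched? (label v)
      ... | yes s with φ v s Fin.≟ p
      redirect-fresh (inj₁ (v , p)) refl | yes s | no ne = p , refl , ne

      redirect-● : ∀ t {i} → redirect G φ t ≡ inj₁ (inj₂ i) → t ≡ inj₂ i
      redirect-● (inj₂ i) refl = refl
      redirect-● (inj₁ (v , p)) e with switched? (label v)
      ... | yes s with φ v s Fin.≟ p
      redirect-● (inj₁ (v , p)) () | yes s | yes _
      redirect-● (inj₁ (v , p)) () | yes s | no _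

      redirect-kept : ∀ v p → (∀ s → φ v s ≡ p) → redirect G φ (inj₁ (v , p)) ≡ inj₁ (inj₁ v)
      redirect-kept v p h with switched? (label v)
      ... | no _ = refl
      ... | yes s with φ v s Fin.≟ p
      ...   | yes _ = refl
      ...   | no ne = contradiction (h s) ne

      redirect-redirected : ∀ v p s → φ v s ≢ p → redirect G φ (inj₁ (v , p)) ≡ inj₂ (v , s)
      redirect-redirected v p s h with switched? (label v)
      ... | no ¬s = contradiction s ¬s
      ... | yes s′ with φ v s′ Fin.≟ p
      ...   | yes e = contradiction (subst (λ s → φ v s ≡ p) (switched-irrelevant s′ s) e) h
      ...   | no _  = cong (λ s → inj₂ (v , s)) (switched-irrelevant s′ s)

      -- A ● node has one premise, the fresh vertex of a switched node receives one redirected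
      -- premise, and a node that is not a ⊗ keeps at most one.
      redirect-injective : ∀ {t t′} → ¬ IntoTensor G t → ¬ IntoTensor G t′ → redirect G φ t ≡ redirect G φ t′ → t ≡ t′
      redirect-injective {t} {t′} ¬t ¬t′ e with redirect G φ t in eq
      ... | inj₁ (inj₂ i) = trans (redirect-● t eq) (sym (redirect-● t′ (sym e)))
      ... | inj₂ (v , s) with redirect-fresh t eq | redirect-fresh t′ (sym e)
      ...   | p , refl , ne | q , refl , ne′ = cong (λ p → inj₁ (v , p)) (redirected-unique s ne ne′)
      redirect-injective {t} {t′} ¬t ¬t′ e | inj₁ (inj₁ v) with redirect-node t eq | redirect-node t′ (sym e)
      ...   | p , refl , k | q , refl , k′ =
        cong (λ p → inj₁ (v , p)) (kept-unique (label v) (cut-free v) ¬t k k′)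

      ends : Arc → Vertexᵠ × Vertexᵠ
      ends a with intoTensor? G (to target a)
      ... | yes _ = headᵠ a , tailᵠ a
      ... | no _  = tailᵠ a , headᵠ a

      parent child : Arc → Vertexᵠ
      parent = proj₁ ∘ ends
      child  = proj₂ ∘ ends

      joins : ∀ a → Joinsᵠ a (parent a) (child a)
      joins a with intoTensor? G (to target a)
      ... | yes _ = inj₂ (refl , refl)
      ... | no _  = inj₁ (refl , refl)

      -- An arc whose orientation is kept cannot have a core child: a core node with a premise is a
      -- ⊗, and arcs into ⊗ nodes are reversed.
      child-core : ∀ {a v} → child a ≡ inj₁ (inj₁ v) → Core (label v) →
                   IntoTensor G (to target a) × tail a ≡ inj₁ v
      child-core {a} e c with intoTensor? G (to target a)
      child-core refl c | yes t = t , refl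
      child-core {a} e c | no ¬t with redirect-node (to target a) e
      ... | p , eq , _ = contradiction (subst (IntoTensor G) (sym eq) (core-premise c p)) ¬t

      child-other : ∀ {a v} → child a ≡ inj₁ (inj₁ v) → ¬ Core (label v) →
                    ∃[ p ] to target a ≡ inj₁ (v , p)
      child-other {a} e ¬c with intoTensor? G (to target a)
      child-other refl ¬c | yes t = contradiction (tensor-core t) ¬c
      child-other {a} e ¬c | no ¬t with redirect-node (to target a) e
      ... | p , eq , _ = p , eq

      -- Two reversed arcs with the same child leave the same node, where `tensor-unique` applies. A
      -- reversed and a kept arc cannot meet: the child of the first is core, so the second would
      -- enter a ⊗. Two kept arcs fall under `redirect-injective`.
      child-injective : ∀ {a b} → child a ≡ child b → a ≡ b
      child-injective {a} {b} e with intoTensor? G (to target a) | intoTensor? G (to target b)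
      child-injective {v , p} {.v , q} refl | yes t | yes t′ = cong (v ,_) (tensor-unique t t′)
      child-injective {a} {b} e | yes t | no ¬t′ with redirect-node (to target b) (sym e)
      ... | p , eq , _ = contradiction (subst (IntoTensor G) (sym eq) (core-premise (tensor-core t) p)) ¬t′
      child-injective {a} {b} e | no ¬t | yes t′ with redirect-node (to target a) e
      ... | p , eq , _ = contradiction (subst (IntoTensor G) (sym eq) (core-premise (tensor-core t′) p)) ¬t
      child-injective {a} {b} e | no ¬t | no ¬t′ = target-injective G (redirect-injective ¬t ¬t′ e)

      Root : Set
      Root = Σ Node (Weakening ∘ label) ⊎ Foci G

      rootNode : Root → Node
      rootNode (inj₁ (v , _)) = v
      rootNode (inj₂ (v , _)) = v

      rootNode-injective : ∀ {r s} → rootNode r ≡ rootNode s → r ≡ s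
      rootNode-injective {inj₁ _} {inj₁ _} e = cong inj₁ (Σ≡ weakening-irrelevant e)
      rootNode-injective {inj₁ (_ , w)} {inj₂ (_ , c , _)} refl = contradiction c (weakening-core w)
      rootNode-injective {inj₂ (_ , c , _)} {inj₁ (_ , w)} refl = contradiction c (weakening-core w)
      rootNode-injective {inj₂ _} {inj₂ _} e = cong inj₂ (Σ≡ (focus-irrelevant G) e)

      rep : Root → Vertexᵠ
      rep = inj₁ ∘ inj₁ ∘ rootNode

      rep-injective : ∀ {r s} → rep r ≡ rep s → r ≡ s
      rep-injective = rootNode-injective ∘ inj₁-injective ∘ inj₁-injective

      root-no-child : ∀ r a → child a ≢ rep r
      root-no-child (inj₁ (v , w)) a e with child-other e (weakening-core w)
      ... | p , _ = weakening-premise w p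
      root-no-child (inj₂ (v , c , f)) a e with child-core e c
      ... | t , refl = toWitnessFalse f (_ , t)

      child-tensor : ∀ {a} → IntoTensor G (to target a) → child a ≡ tailᵠ a
      child-tensor {a} t with intoTensor? G (to target a)
      ... | yes _ = refl
      ... | no ¬t = contradiction t ¬t

      child-head : ∀ {a t} → ¬ IntoTensor G t → to target a ≡ t → child a ≡ redirect G φ t
      child-head {a} ¬t refl with intoTensor? G (to target a)
      ... | yes t = contradiction t ¬t
      ... | no _  = refl

      ¬switched-tensor : ∀ {v} → Switched (label v) → label v ≢ tensor
      ¬switched-tensor s e = switched-core s (subst Core (sym e) tensor)

      child-or-root : ∀ x → (∃[ a ] x ≡ child a) ⊎ (∃[ r ] x ≡ rep r)
      child-or-root (inj₁ (inj₂ i)) = inj₁ (outer i , sym (child-head (λ ()) (strictlyInverseˡ target _)))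
      child-or-root (inj₂ (v , s)) =
        inj₁ (premise v p , sym (trans (child-head (¬switched-tensor s) (target-premise G v p))
                                       (redirect-redirected v p s (opposite-≢ s _))))
        where p = opposite s (φ v s)
      child-or-root (inj₁ (inj₁ v)) with shape (label v) (cut-free v)
      ... | weakening w = inj₂ (inj₁ (v , w) , refl)
      ... | switched s =
        inj₁ (premise v (φ v s) , sym (trans (child-head (¬switched-tensor s) (target-premise G v _))
          (redirect-kept v (φ v s) λ s′ → cong (φ v) (switched-irrelevant s′ s))))
      ... | der e =
        inj₁ (premise v p , sym (trans (child-head (λ t → case trans (sym e) t of λ ()) (target-premise G v p))
          (redirect-kept v p λ s → case subst Switched e s of λ ())))
        where p = subst (Fin ∘ #in) (sym e) 0F
      ... | core c with feedsTensor? G v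
      ...   | yes (p , t) = inj₁ ((v , p) , sym (child-tensor t))
      ...   | no ¬t = inj₂ (inj₂ (v , c , fromWitnessFalse ¬t) , refl)

      open OrientedForest (switchingGraph G φ) rep child parent joins child-injective rep-injective
                          root-no-child child-or-root

      ≺-node : ∀ {x y} → x ≺ y → ∃[ u ] x ≡ inj₁ (inj₁ u)
      ≺-node (a , refl , _) with intoTensor? G (to target a)
      ≺-node (a , refl , _) | no _ = _ , refl
      ≺-node (a , refl , _) | yes t with to target a
      ≺-node (a , refl , _) | yes t | inj₁ (w , q) = w , redirect-kept w q λ s → contradiction t (¬switched-tensor s)

      ≺-core : ∀ {u v} → Core (label v) → inj₁ (inj₁ u) ≺ inj₁ (inj₁ v) →
               Core (label u) × _↝_ label target v u
      ≺-core {u} {v} c (a , e , e′) with intoTensor? G (to target a)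
      ≺-core {u} {v} c (a , e , e′) | no ¬t with redirect-node (to target a) (sym e′)
      ... | p , eq , _ = contradiction (subst (IntoTensor G) (sym eq) (core-premise c p)) ¬t
      ≺-core {u} {v} c ((v , p) , e , refl) | yes t with redirect-node (to target (v , p)) (sym e)
      ... | q , eq , _ = subst Core (sym (subst (IntoTensor G) eq t)) tensor , p , q , eq

      ≺-other : ∀ {u v} → ¬ Core (label v) → inj₁ (inj₁ u) ≺ inj₁ (inj₁ v) → _↝_ label target u v
      ≺-other {u} {v} ¬c (a , e , e′) with intoTensor? G (to target a)
      ≺-other {u} {v} ¬c ((v , p) , e , refl) | yes t = contradiction (tensor-core t) ¬c
      ≺-other {u} {v} ¬c ((u , p) , refl , e′) | no ¬t with redirect-node (to target (u , p)) (sym e′)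
      ... | q , eq , _ = p , q , eq

      -- The parent of a core node is the ⊗ below it, again a core node; so this phase of the climb
      -- follows `↝` and stops by `↝-noetherian`.
      core-accessible : ∀ {v} → Acc (Function.flip (_↝_ label target)) v → Core (label v) → Acc _≺_ (inj₁ (inj₁ v))
      core-accessible (acc rec) c = acc λ s → case ≺-node s of λ where
        (_ , refl) → let c′ , t = ≺-core c s in core-accessible (rec t) c′

      -- Outside the core the parent lies above in `R`, so the recursion is on `↝` itself until a
      -- core node is met; from there `core-accessible` takes over for good.
      node-accessible : ∀ {v} → Acc (_↝_ label target) v → Acc _≺_ (inj₁ (inj₁ v))
      node-accessible {v} (acc rec) with core? (label v)
      ... | yes c = core-accessible (↝-noetherian G v) c
      ... | no ¬c = acc λ s → case ≺-node s of λ where (_ , refl) → node-accessible (rec (≺-other ¬c s))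

      ≺-wellFounded : WellFounded _≺_
      ≺-wellFounded x = acc λ s → case ≺-node s of λ where (_ , refl) → node-accessible (↝-wellFounded G _)

      acyclicᵠ : ¬ UndirectedCycleᵠ
      acyclicᵠ = no-undirected-cycle ≺-wellFounded

      componentsᵠ : ∀ {c} → HasComponentsᵠ c ⇔ (Fin c ↔ Root)
      componentsᵠ = mk⇔ (components⇒roots ≺-wellFounded) (roots⇒components ≺-wellFounded)

    weakenings : Fin (#w G) ↔ Σ Node (Weakening ∘ label)
    weakenings = ↔-trans (count↔Σ weakening? weakening-irrelevant (label ∘ to nodes)) (Σ-↔ nodes ↔-refl)

    focus? : Decidable (Focus G)
    focus? v = core? (label v) ×-dec T? _

    roots : ∀ {f} → Fin f ↔ Foci G → ∀ φ → Fin (#w G + f) ↔ Root φ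
    roots F φ = ↔-trans +↔⊎ (weakenings ⊎-↔ F)

    leftmost : Switching G
    leftmost v s = first s
      where
      first : ∀ {ℓ} → Switched ℓ → Fin (#in ℓ)
      first par = 0F
      first ctr = 0F

    -- The roots are the same for all switchings, so `leftmost` is as good a sample as any;
    -- cancelling the weakenings on both sides leaves one focus.
    ACC⇒one-focus : ACC♯w-ground G → Fin 1 ↔ Foci G
    ACC⇒one-focus h with finite-subset G focus? (focus-irrelevant G)
    ... | f , F with +-cancelˡ-≡ (#w G) 1 f (↔⇒≡ (↔-trans (Equivalence.to (componentsᵠ leftmost) (proj₂ (h leftmost)))
                                                       (↔-sym (roots F leftmost))))
    ... | refl = F

    one-focus⇒ACC : Fin 1 ↔ Foci G → ACC♯w-ground G
    one-focus⇒ACC F φ = acyclicᵠ φ , Equivalence.from (componentsᵠ φ) (roots F φ)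

    -- Counting the core nodes.

    TensorPremise : Set
    TensorPremise = Σ[ x ∈ (Σ[ w ∈ Node ] Fin (#in (label w))) ] label (proj₁ x) ≡ tensor

    tensorPremise : ∀ t → IntoTensor G t → TensorPremise
    tensorPremise (inj₁ x) e = x , e

    premise-core : ((x , _) : TensorPremise) → Core (label (proj₁ (from target (inj₁ x))))
    premise-core (x , e) = tensor-core (subst (IntoTensor G) (sym (target-premise G _ _)) e)

    -- A core node that is no focus has, by `tensor-unique`, exactly one conclusion into a ⊗;
    -- conversely the node above a premise of a ⊗ is core because that premise is positive.
    core↔focus⊎premise : Σ Node (Core ∘ label) ↔ (Foci G ⊎ TensorPremise)
    core↔focus⊎premise = mk↔ₛ′ f g f∘g g∘f
      where
      classify : ∀ v → Core (label v) → Dec (∃[ p ] IntoTensor G (to target (v , p))) → Foci G ⊎ TensorPremise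
      classify v c (yes (p , t)) = inj₂ (tensorPremise _ t)
      classify v c (no ¬t)       = inj₁ (v , c , fromWitnessFalse ¬t)
      f : Σ Node (Core ∘ label) → Foci G ⊎ TensorPremise
      f (v , c) = classify v c (feedsTensor? G v)
      g : Foci G ⊎ TensorPremise → Σ Node (Core ∘ label)
      g (inj₁ (v , c , _)) = v , c
      g (inj₂ x)           = _ , premise-core x
      f∘g : ∀ x → f (g x) ≡ x
      f∘g (inj₁ (v , c , h)) with feedsTensor? G v | toWitnessFalse h
      ... | yes t | ¬t = contradiction t ¬t
      ... | no _  | _  = cong inj₁ (Σ≡ (focus-irrelevant G) refl)
      f∘g (inj₂ ((w , q) , e)) with feedsTensor? G (proj₁ (premise w q))
      ... | no ¬t = contradiction (_ , subst (IntoTensor G) (sym (target-premise G w q)) e) ¬t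
      ... | yes (p , t) = cong inj₂ (agree t (trans (cong (λ p → to target (_ , p)) (tensor-unique t t′))
                                                      (target-premise G w q)))
        where
        t′ = subst (IntoTensor G) (sym (target-premise G w q)) e
        -- The target is generalized to a variable `s`, since `IntoTensor` reduces only on a
        -- constructor.
        agree : ∀ {s} (t : IntoTensor G s) → s ≡ inj₁ (w , q) → tensorPremise s t ≡ ((w , q) , e)
        agree t refl = cong (_ ,_) (≡-irrelevant t e)
      g∘f : ∀ x → g (f x) ≡ x
      g∘f (v , c) with feedsTensor? G v
      ... | no ¬t = refl
      ... | yes (p , t) = Σ≡ core-irrelevant (agree t refl)
        where
        agree : ∀ {s} (t : IntoTensor G s) → to target (v , p) ≡ s →
                proj₁ (from target (inj₁ (proj₁ (tensorPremise s t)))) ≡ v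
        agree {inj₁ _} t e = sym (cong proj₁ (premise-target G e))

    tensorPremise↔ : TensorPremise ↔ (Σ Node ((_≡ tensor) ∘ label) × Fin 2)
    tensorPremise↔ = mk↔ₛ′
      (λ ((w , q) , e) → (w , e) , subst (Fin ∘ #in) e q)
      (λ ((w , e) , q) → (w , subst (Fin ∘ #in) (sym e) q) , e)
      (λ ((w , e) , q) → cong ((w , e) ,_) (subst-subst-sym e))
      (λ ((w , q) , e) → cong (λ q → (w , q) , e) (subst-sym-subst e))

    -- A double count of the core nodes: `l + t` as leaves and tensors, `f + 2t` as foci and
    -- premises of tensors. With `l = t + 1` this gives `f = 1`.
    leaf⊎tensor⇒one-focus : ∀ {l t} → Fin (suc t) ↔ Fin l → Fin t ↔ Σ Node ((_≡ tensor) ∘ label) →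
                            Fin (l + t) ↔ Σ Node (Core ∘ label) → Fin 1 ↔ Foci G
    leaf⊎tensor⇒one-focus {l} {t} b T C with finite-subset G focus? (focus-irrelevant G)
    ... | f , F = subst (λ c → Fin c ↔ Foci G) f≡1 F
      where
      total : Fin (l + t) ↔ Fin (f + t * 2)
      total = ↔-trans C (↔-trans core↔focus⊎premise (↔-trans
        (↔-sym F ⊎-↔ ↔-trans tensorPremise↔ (↔-trans (↔-sym T ×-↔ ↔-refl) (↔-sym *↔×))) (↔-sym +↔⊎)))
      f≡1 : f ≡ 1
      f≡1 = +-cancelʳ-≡ (t * 2) f 1 (trans (sym (↔⇒≡ total)) (trans (cong (_+ t) (sym (↔⇒≡ b)))
              (cong suc (trans (cong (t +_) (sym (+-identityʳ t))) (*-comm 2 t)))))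

  -- Balance of the structure of a proof.

  GroundProperty : Set₁
  GroundProperty = ∀ {n} {Γ : Vec Formula n} → Ground Γ → Set

  BalancedGround : GroundProperty
  BalancedGround G = Balanced (Ground.label G)

  mutual
    everywhere-zip : {P Q T : GroundProperty} → (∀ {n} {Γ : Vec Formula n} (G : Ground Γ) → P G → Q G → T G) →
                     (R : ProofStructure Γ) → Everywhere P R → Everywhere Q R → Everywhere T R
    everywhere-zip f (ps G c) p q = record
      { at-ground = f G (at-ground p) (at-ground q)
      ; in-boxes  = λ v e → content-zip f (c v e) (in-boxes p v e) (in-boxes q v e)
      }

    -- Matching on `boxContent` exposes `body` as a subterm and so makes the recursion structural;
    -- the mutual pairs below are split for the same reason.
    content-zip : {P Q T : GroundProperty} → (∀ {n} {Γ : Vec Formula n} (G : Ground Γ) → P G → Q G → T G) →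
                  {G : Ground Γ} {v : Ground.Node G} → ∀ {k} {e : Ground.label G v ≡ box k} (c : Content G v e) →
                  Everywhere P (Content.body c) → Everywhere Q (Content.body c) → Everywhere T (Content.body c)
    content-zip f (boxContent body _ _ _) = everywhere-zip f body

  -- Axiom, 𝟏 and promotion produce a single leaf, the two binary rules join two balanced structures
  -- by a junction, and every other rule adds a node that is neither or only permutes the
  -- conclusions. A box counts as one leaf because its content is treated separately.
  proof-balanced : (π : Proof Γ) → Everywhere BalancedGround (π °)
  proof-balanced (axiom A) = record
    { at-ground = leaf-balanced ax ; in-boxes = λ _ () }
  proof-balanced (cut-rule π π′) = record
    { at-ground = junction-balanced cut (at-ground (proof-balanced π)) (at-ground (proof-balanced π′))
    ; in-boxes  = λ { (inj₁ (inj₁ v)) e → in-boxes (proof-balanced π) v e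
                    ; (inj₁ (inj₂ v)) e → in-boxes (proof-balanced π′) v e
                    ; (inj₂ _) () } }
  proof-balanced (exchange σ _ π) = record
    { at-ground = at-ground (proof-balanced π) ; in-boxes = in-boxes (proof-balanced π) }
  proof-balanced (⊗-rule π π′) = record
    { at-ground = junction-balanced tensor (at-ground (proof-balanced π)) (at-ground (proof-balanced π′))
    ; in-boxes  = λ { (inj₁ (inj₁ v)) e → in-boxes (proof-balanced π) v e
                    ; (inj₁ (inj₂ v)) e → in-boxes (proof-balanced π′) v e
                    ; (inj₂ _) () } }
  proof-balanced 𝟏-rule = record
    { at-ground = leaf-balanced one ; in-boxes = λ _ () }
  proof-balanced (⅋-rule π) = record
    { at-ground = neutral-balanced (λ ()) (λ ()) (at-ground (proof-balanced π))
    ; in-boxes  = λ { (inj₁ v) e → in-boxes (proof-balanced π) v e ; (inj₂ _) () } }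
  proof-balanced (⊥-rule π) = record
    { at-ground = neutral-balanced (λ ()) (λ ()) (at-ground (proof-balanced π))
    ; in-boxes  = λ { (inj₁ v) e → in-boxes (proof-balanced π) v e ; (inj₂ _) () } }
  proof-balanced (dereliction π) = record
    { at-ground = neutral-balanced (λ ()) (λ ()) (at-ground (proof-balanced π))
    ; in-boxes  = λ { (inj₁ v) e → in-boxes (proof-balanced π) v e ; (inj₂ _) () } }
  proof-balanced (weakening π) = record
    { at-ground = neutral-balanced (λ ()) (λ ()) (at-ground (proof-balanced π))
    ; in-boxes  = λ { (inj₁ v) e → in-boxes (proof-balanced π) v e ; (inj₂ _) () } }
  proof-balanced (contraction π) = record
    { at-ground = neutral-balanced (λ ()) (λ ()) (at-ground (proof-balanced π))
    ; in-boxes  = λ { (inj₁ v) e → in-boxes (proof-balanced π) v e ; (inj₂ _) () } }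
  proof-balanced (promotion π) = record
    { at-ground = leaf-balanced box
    ; in-boxes  = λ { _ refl → proof-balanced π } }

  -- Invariance of balance under isomorphism, and the criterion for balanced structures.

  module _ {R : ProofStructure Γ} {S : ProofStructure Δ} {σ : Permutation _ _} (R≅S : R ≅⟨ σ ⟩ S) where

    open _≅⟨_⟩_ R≅S using (node-iso; label-iso; box-iso)

    Σ-label-iso : (P : Label → Set) →
                  Σ _ (P ∘ Ground.label (ground R)) ↔ Σ _ (P ∘ Ground.label (ground S))
    Σ-label-iso P = Σ-↔ node-iso λ {v} → mk↔ₛ′
      (subst P (sym (label-iso v))) (subst P (label-iso v))
      (λ _ → subst-sym-subst (label-iso v)) (λ _ → subst-subst-sym (label-iso v))

    ≅-balanced : BalancedGround (ground R) → BalancedGround (ground S)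
    ≅-balanced b = ↔-trans (↔-sym (Σ-label-iso Leaf)) (↔-trans b (↔-refl ⊎-↔ Σ-label-iso Junction))

    ≅-body : ∀ w {k} (e : Ground.label (ground S) w ≡ box k) →
             ∃[ v ] Σ[ e′ ∈ Ground.label (ground R) v ≡ box k ] ∃[ τ ]
               Content.body (content R v e′) ≅⟨ τ ⟩ Content.body (content S w e)
    ≅-body w e = at (strictlyInverseˡ node-iso w) e
      where
      -- Generalized over `w`, so that `w` can be replaced by `to node-iso v`; the two proofs of the
      -- label equation are then identified by `≡-irrelevant`.
      at : ∀ {w v} → to node-iso v ≡ w → ∀ {k} (e : Ground.label (ground S) w ≡ box k) →
           ∃[ v ] Σ[ e′ ∈ Ground.label (ground R) v ≡ box k ] ∃[ τ ]
             Content.body (content R v e′) ≅⟨ τ ⟩ Content.body (content S w e)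
      at {v = v} refl e = v , e′ ,
        subst (λ e → ∃[ τ ] Content.body (content R v e′) ≅⟨ τ ⟩ Content.body (content S _ e))
              (≡-irrelevant _ _) (_ , proj₂ (proj₂ (proj₂ (box-iso v e′))))
        where e′ = trans (sym (label-iso v)) e

  mutual
    ≅-everywhere-balanced : {R : ProofStructure Γ} (S : ProofStructure Δ) {σ : Permutation _ _} → R ≅⟨ σ ⟩ S →
                            Everywhere BalancedGround R → Everywhere BalancedGround S
    ≅-everywhere-balanced (ps G c) R≅S b = record
      { at-ground = ≅-balanced R≅S (at-ground b)
      ; in-boxes  = λ w e → let v , e′ , _ , i = ≅-body R≅S w e in
                    ≅-content-balanced (c w e) i (in-boxes b v e′)
      }

    ≅-content-balanced : {R : ProofStructure Γ} {G : Ground Δ} {v : Ground.Node G} {e : Ground.label G v ≡ box k}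
                         (c : Content G v e) {σ : Permutation _ _} → R ≅⟨ σ ⟩ Content.body c →
                         Everywhere BalancedGround R → Everywhere BalancedGround (Content.body c)
    ≅-content-balanced (boxContent body _ _ _) = ≅-everywhere-balanced body

  CutFreePolarizedGround : GroundProperty
  CutFreePolarizedGround G = (∀ v → Ground.label G v ≢ cut) × (∀ a → Polarized (Ground.type G a))

  balanced⇒ACC : (G : Ground Γ) → BalancedGround G → CutFreePolarizedGround G → ACC♯w-ground G
  balanced⇒ACC G b (cut-free , polarized)
    with finite-subset G (leaf? ∘ label) leaf-irrelevant | finite-subset G (tensor? ∘ label) ≡-irrelevant
    where open Ground G
  ... | l , L | t , T = one-focus⇒ACC (leaf⊎tensor⇒one-focus
    -- Without cuts the junctions are the ⊗ nodes, and balance reads `1 + t = l`.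
    (↔-trans (+↔⊎ {1}) (↔-trans (1↔⊤ ⊎-↔ ↔-trans T (Σ-↔ ↔-refl (tensor↔junction (cut-free _))))
             (↔-trans (↔-sym b) (↔-sym L))))
    T
    (↔-trans +↔⊎ (↔-trans (L ⊎-↔ T) (↔-trans (↔-sym Σ-distribˡ-⊎) (Σ-↔ ↔-refl leaf⊎tensor↔core)))))
    where open CutFreePolarized G cut-free polarized

  -- Reordering touches neither nodes nor arcs between nodes, so it is undone by `τ` on the
  -- conclusions. This absorbs the exchange that precedes a promotion.
  ≅-reorder : {R : ProofStructure Δ} {S : ProofStructure Δ} {Θ : Vec Formula k}
              (σ : Permutation _ k) (h : ∀ i → lookup Θ (σ ⟨$⟩ʳ i) ≡ lookup Δ i) {τ : Permutation k _} →
              (∀ i → τ ⟨$⟩ʳ (σ ⟨$⟩ʳ i) ≡ i) → R ≅ S → reorder {Δ = Θ} σ h R ≅⟨ τ ⟩ S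
  ≅-reorder {R = R} {S = S} {Θ} σ h {τ} inv i = record
    { node-iso  = node-iso ; arc-iso = arc-iso ; label-iso = label-iso ; type-iso = type-iso
    ; tail-iso  = tail-iso
    ; head-iso  = head-iso′
    ; order-iso = order-iso′
    ; box-iso   = box-iso
    }
    where
    open _≅⟨_⟩_ i
    module R = Ground (ground R)
    module S = Ground (ground S)
    module R′ = Ground (ground (reorder {Δ = Θ} σ h R))
    head-iso′ : ∀ a → S.head (to arc-iso a) ≡ Sum.map (to node-iso) (τ ⟨$⟩ʳ_) (R′.head a)
    head-iso′ a with to R.target a | head-iso a
    ... | inj₁ _ | e = e
    ... | inj₂ j | e = trans e (cong inj₂ (sym (inv j)))
    order-iso′ : ∀ {a v p w q} → Ordered (R.label v) →
                 to R′.target a ≡ inj₁ (v , p) → to S.target (to arc-iso a) ≡ inj₁ (w , q) → toℕ q ≡ toℕ p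
    order-iso′ {a} o e e′ with to R.target a in eq
    order-iso′ {a} o refl e′ | inj₁ _ = order-iso o eq e′

  -- Embeddings of partial structures into `R`.

  module Embeddings {n : ℕ} {Γ : Vec Formula n} (R : ProofStructure Γ) where

    open Ground (ground R)

    premiseAs : ∀ {v ℓ} → label v ≡ ℓ → Fin (#in ℓ) → Arc
    premiseAs {v} e q = premise v (subst (Fin ∘ #in) (sym e) q)

    conclusionAs : ∀ {v ℓ} → label v ≡ ℓ → Fin (#out ℓ) → Arc
    conclusionAs {v} e p = conclusion v (subst (Fin ∘ #out) (sym e) p)

    typedAs : ∀ {v ℓ} (e : label v ≡ ℓ) → Typed ℓ (type ∘ premiseAs e) (type ∘ conclusionAs e)
    typedAs refl = typed _

    -- An isomorphism of S with an upward closed part of R which moreover keeps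
    -- the numbering of all ports.  The conclusions of S become the frontier.
    record Embedding {m : ℕ} {Δ : Vec Formula m} (S : ProofStructure Δ) : Set where
      private module S = Ground (ground S)
      field
        node           : S.Node → Node
        node-injective : ∀ {v w} → node v ≡ node w → v ≡ w
        label≡         : ∀ v → label (node v) ≡ S.label v

      arc : S.Arc → Arc
      arc (v , p) = conclusionAs (label≡ v) p

      port : (Σ[ v ∈ S.Node ] Fin (#in (S.label v))) → Σ[ v ∈ Node ] Fin (#in (label v))
      port (v , p) = node v , subst (Fin ∘ #in) (sym (label≡ v)) p

      field
        type≡ : ∀ a → type (arc a) ≡ S.type a
        wired : ∀ {a x} → to S.target a ≡ inj₁ x → to target (arc a) ≡ inj₁ (port x)
        boxes : ∀ v {k} (e : S.label v ≡ box k) →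
                let c = content S v e ; c′ = content R (node v) (trans (label≡ v) e) in
                Content.body c ≅⟨ flip (Content.door c) ∘ₚ id ∘ₚ Content.door c′ ⟩ Content.body c′

      frontier : Fin m → Arc
      frontier i = arc (S.outer i)

      Covered : Node → Set
      Covered v = ∃[ u ] node u ≡ v

      arc-injective : ∀ {a b} → arc a ≡ arc b → a ≡ b
      arc-injective {v , p} {w , q} e with node-injective (cong proj₁ e)
      -- Ports are compared as numbers, which transport along label equations preserves.
      ... | refl = cong (v ,_) (toℕ-injective (trans (sym (toℕ-subst #out _ p)) (trans (agree e) (toℕ-subst #out _ q))))
        where
        agree : ∀ {a b : Arc} → a ≡ b → toℕ (proj₂ a) ≡ toℕ (proj₂ b)
        agree refl = refl

      covered-arc : ∀ a → Covered (proj₁ a) → ∃[ b ] arc b ≡ a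
      covered-arc (_ , p) (u , refl) =
        (u , subst (Fin ∘ #out) (label≡ u) p) , cong (node u ,_) (subst-sym-subst (label≡ u))

      -- If the preimage of `a` entered a node of `S`, then `wired` would make `v` covered; so it is
      -- a conclusion of `S`. Thus the premises of the next node are found in the current sequent.
      covered-premise : ∀ {v a q} → ¬ Covered v → to target a ≡ inj₁ (v , q) → Covered (proj₁ a) →
                        ∃[ i ] frontier i ≡ a
      covered-premise {a = a} fresh e c with covered-arc a c
      ... | b , refl with to S.target b in eq
      ...   | inj₂ i = i , cong arc (trans (cong (from S.target) (sym eq)) (strictlyInverseʳ S.target b))
      ...   | inj₁ (w , q) with trans (sym (wired eq)) e
      ...     | refl = contradiction (w , refl) fresh

      frontier-type : ∀ i → type (frontier i) ≡ lookup Δ i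
      frontier-type i = trans (type≡ _) (S.outer-type i)

    open Embedding

    reorder-embedding : {S : ProofStructure Δ} {Θ : Vec Formula k} (σ : Permutation _ k)
                        (h : ∀ i → lookup Θ (σ ⟨$⟩ʳ i) ≡ lookup Δ i) → Embedding S → Embedding (reorder {Δ = Θ} σ h S)
    reorder-embedding {S = S} {Θ} σ h E = record
      { node = node E ; node-injective = node-injective E ; label≡ = label≡ E ; type≡ = type≡ E
      ; wired = wired′ ; boxes = boxes E }
      where
      module S = Ground (ground S)
      module S′ = Ground (ground (reorder {Δ = Θ} σ h S))
      wired′ : ∀ {a x} → to S′.target a ≡ inj₁ x → to target (arc E a) ≡ inj₁ (port E x)
      wired′ {a} e with to S.target a in eq
      wired′ {a} refl | inj₁ x = wired E eq

    single-embedding : ∀ {ℓ} (Θ : Vec Formula (#out ℓ)) (np : ¬ Fin (#in ℓ)) (t : ∀ i → Typed ℓ i (lookup Θ)) c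
                       {v} (e : label v ≡ ℓ) → (∀ p → type (conclusionAs e p) ≡ lookup Θ p) →
                       let S = ps (Single.result ℓ Θ np t) c in
                       (∀ {k} (b : ℓ ≡ box k) → let d = c tt b ; d′ = content R v (trans e b) in
                         Content.body d ≅⟨ flip (Content.door d) ∘ₚ id ∘ₚ Content.door d′ ⟩ Content.body d′) →
                       Embedding S
    single-embedding Θ np t c {v} e h b = record
      { node = λ _ → v ; node-injective = λ _ → refl ; label≡ = λ _ → e
      ; type≡ = λ (_ , p) → h p ; wired = λ () ; boxes = λ _ → b }

    ∥-embedding : {S : ProofStructure Δ} {T : ProofStructure Δ′} (E : Embedding S) (F : Embedding T) →
                  (∀ {v} → Covered E v → ¬ Covered F v) → Embedding (S ∥ T)
    ∥-embedding {S = S} {T = T} E F disjoint = record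
      { node           = [ node E , node F ]′
      ; node-injective = λ { {inj₁ _} {inj₁ _} e → cong inj₁ (node-injective E e)
                           ; {inj₂ _} {inj₂ _} e → cong inj₂ (node-injective F e)
                           ; {inj₁ v} {inj₂ w} e → contradiction (w , refl) (disjoint (v , e))
                           ; {inj₂ v} {inj₁ w} e → contradiction (v , refl) (disjoint (w , sym e)) }
      ; label≡         = label≡′
      ; type≡          = λ { (inj₁ v , p) → type≡ E (v , p) ; (inj₂ v , p) → type≡ F (v , p) }
      ; wired          = λ {a} → wired′ {a}
      ; boxes          = λ { (inj₁ v) → boxes E v ; (inj₂ v) → boxes F v }
      }
      where
      module S = Ground (ground S)
      module T = Ground (ground T)
      module U = Ground (ground (S ∥ T))
      label≡′ : ∀ v → label ([ node E , node F ]′ v) ≡ U.label v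
      label≡′ (inj₁ v) = label≡ E v
      label≡′ (inj₂ v) = label≡ F v
      wired′ : ∀ {a x} → to U.target a ≡ inj₁ x →
               to target (conclusionAs (label≡′ (proj₁ a)) (proj₂ a)) ≡
               inj₁ ([ node E , node F ]′ (proj₁ x) , subst (Fin ∘ #in) (sym (label≡′ (proj₁ x))) (proj₂ x))
      wired′ {inj₁ v , p} e with to S.target (v , p) in eq
      wired′ {inj₁ v , p} refl | inj₁ _ = wired E eq
      wired′ {inj₂ v , p} e with to T.target (v , p) in eq
      wired′ {inj₂ v , p} refl | inj₁ _ = wired F eq

    attach-embedding : ∀ ℓ (Φ : Vec Formula m) (Θ : Vec Formula (#in ℓ)) (Θ′ : Vec Formula (#out ℓ)) (Ψ : Vec Formula k)
                       (nb : ∀ k → ℓ ≢ box k) (t : Typed ℓ (lookup Θ) (lookup Θ′)) {S : ProofStructure (Φ ++ Θ ++ Ψ)}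
                       (E : Embedding S) {v} (e : label v ≡ ℓ) → ¬ Covered E v →
                       (∀ q → frontier E (m ↑ʳ (q ↑ˡ k)) ≡ premiseAs e q) →
                       (∀ p → type (conclusionAs e p) ≡ lookup Θ′ p) →
                       Embedding (attach ℓ Φ Θ Θ′ Ψ nb t S)
    attach-embedding {m = m} {k = k} ℓ Φ Θ Θ′ Ψ nb t {S} E {v} e fresh h h′ = record
      { node           = node′
      ; node-injective = λ { {inj₁ _} {inj₁ _} e → cong inj₁ (node-injective E e)
                           ; {inj₂ _} {inj₂ _} e → refl
                           ; {inj₁ u} {inj₂ _} e → contradiction (u , e) fresh
                           ; {inj₂ _} {inj₁ u} e → contradiction (u , sym e) fresh }
      ; label≡         = label≡′
      ; type≡          = λ { (inj₁ v , p) → type≡ E (v , p) ; (inj₂ _ , p) → h′ p }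
      ; wired          = λ {a} → wired′ {a}
      ; boxes          = λ { (inj₁ v) → boxes E v ; (inj₂ _) b → contradiction b (nb _) }
      }
      where
      module S = Ground (ground S)
      S′ : ProofStructure (Φ ++ Θ′ ++ Ψ)
      S′ = attach ℓ Φ Θ Θ′ Ψ nb t S
      module S′ = Ground (ground S′)
      node′ : S′.Node → Node
      node′ = [ node E , (λ _ → v) ]′
      label≡′ : ∀ v → label (node′ v) ≡ S′.label v
      label≡′ (inj₁ v) = label≡ E v
      label≡′ (inj₂ _) = e
      wired′ : ∀ {a x} → to S′.target a ≡ inj₁ x →
               to target (conclusionAs (label≡′ (proj₁ a)) (proj₂ a)) ≡
               inj₁ (node′ (proj₁ x) , subst (Fin ∘ #in) (sym (label≡′ (proj₁ x))) (proj₂ x))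
      wired′ {inj₁ u , p} d with to S.target (u , p) in eq
      wired′ {inj₁ u , p} refl | inj₁ _ = wired E eq
      wired′ {inj₁ u , p} d | inj₂ i with to (split₃ m (#in ℓ) k) i in eq′
      -- This arc was a conclusion of `S` in the block `Θ` and now enters the new node; `h` says
      -- that its image is the corresponding premise of `v`.
      wired′ {inj₁ u , p} refl | inj₂ i | inj₂ (inj₁ q) =
        trans (cong (to target) (trans (cong (arc E) a≡) (h q))) (strictlyInverseˡ target _)
        where
        a≡ : (u , p) ≡ S.outer (m ↑ʳ (q ↑ˡ k))
        a≡ = trans (sym (strictlyInverseʳ S.target (u , p))) (cong (from S.target) (trans eq (cong inj₂
               (trans (sym (strictlyInverseʳ (split₃ m (#in ℓ) k) i)) (cong (from (split₃ m (#in ℓ) k)) eq′)))))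

  -- Embeddings that cover all nodes are isomorphisms.

  module Completion {n : ℕ} {Γ : Vec Formula n} (R : ProofStructure Γ) where

    open Ground (ground R)
    open Embeddings R

    module Complete {S : ProofStructure Δ} (E : Embedding S) (covered : ∀ v → Embedding.Covered E v) where

      open Embedding E

      private module S = Ground (ground S)

      -- Were a frontier arc to enter a node `w`, that port of `w` would already be the target of an
      -- internal arc of `S`, and `arc-injective` would identify an internal arc with a conclusion.
      frontier-outer : ∀ i → ∃[ j ] outer j ≡ frontier i
      frontier-outer i with to target (frontier i) in eq
      ... | inj₂ j = j , trans (cong (from target) (sym eq)) (strictlyInverseʳ target _)
      ... | inj₁ (w , q) with covered w
      ...   | u , refl = contradiction
        (trans (sym (strictlyInverseˡ S.target _))
          (trans (cong (to S.target) (sym (arc-injective same))) (strictlyInverseˡ S.target _))) λ ()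
        where
        q′ = subst (Fin ∘ #in) (label≡ u) q
        same : arc (S.premise u q′) ≡ arc (S.outer i)
        same = target-injective (ground R) (trans (wired (target-premise (ground S) u q′))
                 (trans (cong (λ q → inj₁ (node u , q)) (subst-sym-subst (label≡ u))) (sym eq)))

      outer-frontier : ∀ j → ∃[ i ] frontier i ≡ outer j
      outer-frontier j with covered-arc (outer j) (covered _)
      ... | b , d with to S.target b in eq
      ...   | inj₂ i = i , trans (cong arc (trans (cong (from S.target) (sym eq)) (strictlyInverseʳ S.target b))) d
      ...   | inj₁ x =
        contradiction (trans (sym (wired eq)) (trans (cong (to target) d) (strictlyInverseˡ target _))) λ ()

      outer-injective : ∀ {i j} → outer i ≡ outer j → i ≡ j
      outer-injective {i} {j} e = inj₂-injective (trans (sym (strictlyInverseˡ target (inj₂ i)))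
                                    (trans (cong (to target) e) (strictlyInverseˡ target (inj₂ j))))

      frontier-injective : ∀ {i j} → frontier i ≡ frontier j → i ≡ j
      frontier-injective {i} {j} e = inj₂-injective
        (trans (sym (strictlyInverseˡ S.target (inj₂ i)))
          (trans (cong (to S.target) (arc-injective e)) (strictlyInverseˡ S.target (inj₂ j))))

      -- The conclusions of `S` come in the order in which they happened to be produced; this is the
      -- final exchange that restores the order prescribed by `R`.
      order : Permutation _ n
      order = bijection (proj₁ ∘ frontier-outer)
        (λ {i} {j} e → frontier-injective
          (trans (sym (proj₂ (frontier-outer i))) (trans (cong outer e) (proj₂ (frontier-outer j)))))
        (λ j → let i , e = outer-frontier j in i , outer-injective (trans (proj₂ (frontier-outer i)) e))

      frontier-order : ∀ i → outer (order ⟨$⟩ʳ i) ≡ frontier i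
      frontier-order i = proj₂ (frontier-outer i)

    complete-≅ : {S : ProofStructure Γ} (E : Embedding S) → (∀ v → Embedding.Covered E v) →
                 (∀ i → Embedding.frontier E i ≡ outer i) → S ≅ R
    complete-≅ {S} E covered frontier≡ = record
      { node-iso  = bijection node node-injective covered
      ; arc-iso   = bijection arc arc-injective (λ a → covered-arc a (covered _))
      ; label-iso = label≡
      ; type-iso  = type≡
      ; tail-iso  = λ _ → refl
      ; head-iso  = head-iso
      ; order-iso = λ {a} {v} {p} {w} {q} _ → order-iso {a} {v} {p} {w} {q}
      ; box-iso   = λ v e → id , refl , (λ p → cong (node v ,_) (subst-subst-syms (label≡ v) e p)) , boxes v e
      }
      where
      open Embedding E
      module S = Ground (ground S)
      head-iso : ∀ a → head (arc a) ≡ Sum.map node (id ⟨$⟩ʳ_) (S.head a)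
      head-iso a with to S.target a in eq
      ... | inj₁ x = cong (Sum.map₁ proj₁) (wired eq)
      ... | inj₂ i = cong (Sum.map₁ proj₁) (trans (cong (to target)
            (trans (cong arc (trans (sym (strictlyInverseʳ S.target a)) (cong (from S.target) eq))) (frontier≡ i)))
            (strictlyInverseˡ target _))
      order-iso : ∀ {a v p w q} → to S.target a ≡ inj₁ (v , p) → to target (arc a) ≡ inj₁ (w , q) → toℕ q ≡ toℕ p
      order-iso {p = p} e d with refl ← trans (sym d) (wired e) = toℕ-subst #in _ p

  -- Partial proofs embedded in a structure with a single focus.

  module Construction {n : ℕ} {Γ : Vec Formula n} (R : ProofStructure Γ)
    (cut-free : ∀ v → Ground.label (ground R) v ≢ cut)
    (polarized : ∀ a → Polarized (Ground.type (ground R) a))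
    (one-focus : Fin 1 ↔ Foci (ground R))
    (boxes-sequentializable : ∀ v {k} (e : Ground.label (ground R) v ≡ box k) →
                              Sequentializable LLpol (Content.body (content R v e)))
    where

    open Ground (ground R)
    open Embeddings R
    open CutFreePolarized (ground R) cut-free polarized
    open Completion R

    private
      G = ground R

    -- Every formula of the sequent of a partial proof is the type of an arc of `R`, so membership
    -- in the fragment is inherited.
    sequent-polarized : {S : ProofStructure Δ} → Embedding S → All Polarized Δ
    sequent-polarized E = lookup⁻ λ i → subst Polarized (Embedding.frontier-type E i) (polarized _)

    record Partial {m : ℕ} (Δ : Vec Formula m) : Set where
      field
        proof     : Proof Δ
        valid     : AllSequentsIn LLpol proof
        embedding : Embedding (proof °)
      open Embedding embedding public

    open Partial

    permute : (σ : Permutation m k) {Θ : Vec Formula k} → (∀ i → lookup Θ (σ ⟨$⟩ʳ i) ≡ lookup Δ i) →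
              Partial Δ → Partial Θ
    permute σ h P = record
      { proof = exchange σ h (proof P) ; valid = sequent-polarized E , valid P ; embedding = E }
      where E = reorder-embedding σ h (embedding P)

    -- The chosen formulae go last for the unary rules and the left premise of a ⊗ rule, and first
    -- for its right premise.
    module Arrange {m c k : ℕ} {Δ : Vec Formula m} (P : Partial Δ) (ψ : Fin m ↔ (Fin c ⊎ Fin k)) (Θ : Vec Formula k)
                   (hΘ : ∀ q → type (frontier P (from ψ (inj₂ q))) ≡ lookup Θ q) where

      rest : Vec Formula c
      rest = tabulate λ j → type (frontier P (from ψ (inj₁ j)))

      types : ∀ s → [ lookup rest , lookup Θ ]′ s ≡ type (frontier P (from ψ s))
      types (inj₁ j) = lookup∘tabulate _ j
      types (inj₂ q) = sym (hΘ q)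

      types-at : ∀ i → [ lookup rest , lookup Θ ]′ (to ψ i) ≡ lookup Δ i
      types-at i = trans (types (to ψ i)) (trans (frontier-type P _) (cong (lookup Δ) (strictlyInverseʳ ψ i)))

      last : Partial (rest ++ Θ)
      last = permute (↔-trans ψ (↔-sym +↔⊎)) (λ i → trans (lookup-join rest Θ (to ψ i)) (types-at i)) P

      first : Partial (Θ ++ rest)
      first = permute (↔-trans ψ (↔-trans (⊎-comm _ _) (↔-sym +↔⊎)))
                (λ i → trans (lookup-join Θ rest (Sum.swap (to ψ i))) (trans (swapped (to ψ i)) (types-at i))) P
        where
        swapped : ∀ s → [ lookup Θ , lookup rest ]′ (Sum.swap s) ≡ [ lookup rest , lookup Θ ]′ s
        swapped (inj₁ _) = refl
        swapped (inj₂ _) = refl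

      frontier-last : ∀ q → frontier last (c ↑ʳ q) ≡ frontier P (from ψ (inj₂ q))
      frontier-last q = cong (frontier P ∘ from ψ) (splitAt-↑ʳ c k q)

      frontier-first : ∀ q → frontier first (q ↑ˡ c) ≡ frontier P (from ψ (inj₂ q))
      frontier-first q = cong (frontier P ∘ from ψ ∘ Sum.swap) (splitAt-↑ˡ k q c)

    premiseAs-injective : ∀ {v ℓ} (e : label v ≡ ℓ) {p q} → premiseAs e p ≡ premiseAs e q → p ≡ q
    premiseAs-injective {v} refl {p} {q} e with
      trans (sym (target-premise G v p)) (trans (cong (to target) e) (target-premise G v q))
    ... | refl = refl

    target-premiseAs : ∀ {v ℓ} (e : label v ≡ ℓ) q → to target (premiseAs e q) ≡ inj₁ (v , subst (Fin ∘ #in) (sym e) q)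
    target-premiseAs e q = target-premise G _ _

    Ready : Partial Δ → Node → Set
    Ready P v = ¬ Covered P v × (∀ {ℓ} (e : label v ≡ ℓ) q → ∃[ i ] frontier P i ≡ premiseAs e q)

    record State : Set where
      constructor state
      field
        {length}  : ℕ
        {sequent} : Vec Formula length
        partial   : Partial sequent

    open State

    infix 4 _⊆_

    _⊆_ : State → State → Set
    S ⊆ T = ∀ {v} → Covered (partial S) v → Covered (partial T) v

    Added : Partial Δ → Node → Set
    Added P v = ∃[ S ] state P ⊆ S × Covered (partial S) v

    arrange : (P : Partial Δ) {v : Node} → Ready P v → ∀ {ℓ} (e : label v ≡ ℓ) (Θ : Vec Formula (#in ℓ)) →
              (∀ q → type (premiseAs e q) ≡ lookup Θ q) →
              ∃₂ λ c (Φ : Vec Formula c) → Σ[ Q ∈ Partial (Φ ++ Θ) ]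
                (∀ {u} → Covered P u → Covered Q u) × (∀ {u} → Covered Q u → Covered P u) ×
                (∀ q → frontier Q (c ↑ʳ q) ≡ premiseAs e q)
    arrange P ready e Θ hΘ =
      let index q = proj₁ (proj₂ ready e q)
          at q    = proj₂ (proj₂ ready e q)
          c , ψ , h = separate index λ {p} {q} d → premiseAs-injective e
                        (trans (sym (at p)) (trans (cong (frontier P) d) (at q)))
          at′ q   = trans (cong (frontier P) (h q)) (at q)
          open Arrange P ψ Θ (λ q → trans (cong type (at′ q)) (hΘ q))
      in c , rest , last , (λ d → d) , (λ d → d) , λ q → trans (frontier-last q) (at′ q)

    -- Nodes outside the core: the rules with one premise.

    module _ {c : ℕ} {Φ : Vec Formula c} {v : Node} where

      private
        Fits : ∀ {m} {Δ : Vec Formula m} → Partial Δ → ∀ {ℓ} → label v ≡ ℓ → (Fin (#in ℓ) → Fin m) → Set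
        Fits Q e f = ∀ q → frontier Q (f q) ≡ premiseAs e q

      add-der : ∀ {A} (Q : Partial (Φ ++ A ∷ [])) → ¬ Covered Q v → (e : label v ≡ der) → Fits Q e (c ↑ʳ_) →
                type (conclusionAs e 0F) ≡ ⁇ A → Added Q v
      add-der {A} Q fresh e h t = state record { proof = π ; valid = sequent-polarized E , valid Q ; embedding = E }
                                , (λ (u , d) → inj₁ u , d) , (inj₂ tt , refl)
        where
        π = dereliction {Γ = Φ} {A = A} (proof Q)
        E : Embedding (π °)
        E = attach-embedding der Φ (A ∷ []) (⁇ A ∷ []) [] (λ _ ()) refl {S = proof Q °} (embedding Q) e fresh
              (λ { 0F → h 0F }) (λ { 0F → t })

      add-par : ∀ {A B} (Q : Partial (Φ ++ A ∷ B ∷ [])) → ¬ Covered Q v → (e : label v ≡ par) → Fits Q e (c ↑ʳ_) →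
                type (conclusionAs e 0F) ≡ A ⅋ B → Added Q v
      add-par {A} {B} Q fresh e h t = state record { proof = π ; valid = sequent-polarized E , valid Q ; embedding = E }
                                    , (λ (u , d) → inj₁ u , d) , (inj₂ tt , refl)
        where
        π = ⅋-rule {Γ = Φ} {A = A} {B = B} (proof Q)
        E : Embedding (π °)
        E = attach-embedding par Φ (A ∷ B ∷ []) (A ⅋ B ∷ []) [] (λ _ ()) refl {S = proof Q °} (embedding Q) e fresh
              (λ { 0F → h 0F ; 1F → h 1F }) (λ { 0F → t })

      add-ctr : ∀ {A} (Q : Partial (Φ ++ ⁇ A ∷ ⁇ A ∷ [])) → ¬ Covered Q v → (e : label v ≡ ctr) → Fits Q e (c ↑ʳ_) →
                type (conclusionAs e 0F) ≡ ⁇ A → Added Q v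
      add-ctr {A} Q fresh e h t = state record { proof = π ; valid = sequent-polarized E , valid Q ; embedding = E }
                                , (λ (u , d) → inj₁ u , d) , (inj₂ tt , refl)
        where
        π = contraction {Γ = Φ} {A = A} (proof Q)
        E : Embedding (π °)
        E = attach-embedding ctr Φ (⁇ A ∷ ⁇ A ∷ []) (⁇ A ∷ []) [] (λ _ ()) (A , refl , refl , refl) {S = proof Q °}
              (embedding Q) e fresh (λ { 0F → h 0F ; 1F → h 1F }) (λ { 0F → t })

      bot-embedding : label v ≡ bot → Embedding (single bot (⊥′ ∷ []) (λ ()) (λ _ ()) λ _ → refl)
      bot-embedding e = single-embedding (⊥′ ∷ []) (λ ()) (λ _ → refl) (λ _ d → contradiction d λ ()) e
                          (λ { 0F → typedAs e }) (λ ())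

      wkn-embedding : ∀ {A} (e : label v ≡ wkn) → type (conclusionAs e 0F) ≡ ⁇ A →
                      Embedding (single wkn (⁇ A ∷ []) (λ ()) (λ _ ()) λ _ → A , refl)
      wkn-embedding {A} e t = single-embedding (⁇ A ∷ []) (λ ()) (λ _ → A , refl) (λ _ d → contradiction d λ ()) e
                                (λ { 0F → t }) (λ ())

      add-bot : (P : Partial Φ) → ¬ Covered P v → label v ≡ bot → Added P v
      add-bot P fresh e = state record { proof = π ; valid = sequent-polarized E , valid P ; embedding = E }
                        , (λ (u , d) → inj₁ u , d) , (inj₂ tt , refl)
        where
        π = ⊥-rule {Γ = Φ} (proof P)
        E : Embedding (π °)
        E = ∥-embedding {S = proof P °} {T = single bot (⊥′ ∷ []) (λ ()) (λ _ ()) λ _ → refl}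
              (embedding P) (bot-embedding e) λ { d (_ , refl) → fresh d }

      add-wkn : ∀ {A} (P : Partial Φ) → ¬ Covered P v → (e : label v ≡ wkn) → type (conclusionAs e 0F) ≡ ⁇ A → Added P v
      add-wkn {A} P fresh e t = state record { proof = π ; valid = sequent-polarized E , valid P ; embedding = E }
                              , (λ (u , d) → inj₁ u , d) , (inj₂ tt , refl)
        where
        π = weakening {Γ = Φ} {A = A} (proof P)
        E : Embedding (π °)
        E = ∥-embedding {S = proof P °} {T = single wkn (⁇ A ∷ []) (λ ()) (λ _ ()) λ _ → A , refl}
              (embedding P) (wkn-embedding e t) λ { d (_ , refl) → fresh d }

    add : (P : Partial Δ) {v : Node} → Ready P v → ¬ Core (label v) → ∀ ℓ → label v ≡ ℓ → Added P v
    add P ready ¬c cut     e = contradiction e (cut-free _)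
    add P ready ¬c ax      e = contradiction (subst Core (sym e) ax) ¬c
    add P ready ¬c one     e = contradiction (subst Core (sym e) one) ¬c
    add P ready ¬c tensor  e = contradiction (subst Core (sym e) tensor) ¬c
    add P ready ¬c (box k) e = contradiction (subst Core (sym e) box) ¬c
    add P ready ¬c bot     e = add-bot P (proj₁ ready) e
    add P ready ¬c wkn     e = add-wkn P (proj₁ ready) e (proj₂ (typedAs e))
    add P ready ¬c der     e =
      let A = type (premiseAs e 0F)
          c , Φ , Q , P⊆Q , Q⊆P , h = arrange P ready e (A ∷ []) λ { 0F → refl }
          S , Q⊆S , v∈S = add-der Q (proj₁ ready ∘ Q⊆P) e h (typedAs e)
      in S , Q⊆S ∘ P⊆Q , v∈S
    add P ready ¬c par     e =
      let A = type (premiseAs e 0F)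
          B = type (premiseAs e 1F)
          c , Φ , Q , P⊆Q , Q⊆P , h = arrange P ready e (A ∷ B ∷ []) λ { 0F → refl ; 1F → refl }
          S , Q⊆S , v∈S = add-par Q (proj₁ ready ∘ Q⊆P) e h (typedAs e)
      in S , Q⊆S ∘ P⊆Q , v∈S
    add P ready ¬c ctr     e =
      let A , o , i₀ , i₁ = typedAs e
          c , Φ , Q , P⊆Q , Q⊆P , h = arrange P ready e (⁇ A ∷ ⁇ A ∷ []) λ { 0F → i₀ ; 1F → i₁ }
          S , Q⊆S , v∈S = add-ctr Q (proj₁ ready ∘ Q⊆P) e h o
      in S , Q⊆S ∘ P⊆Q , v∈S

    regroup-embedding : ∀ {l m k} (Φ : Vec Formula l) (Θ : Vec Formula m) (Ψ : Vec Formula k)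
                        {S : ProofStructure ((Φ ++ Θ) ++ Ψ)} → Embedding S → Embedding (regroup Φ Θ Ψ S)
    regroup-embedding {l} {m} {k} Φ Θ Ψ {S} E = reorder-embedding {S = S} (cast-id (+-assoc l m k)) (λ i →
      trans (cong (λ Ξ → lookup Ξ (Fin.cast (+-assoc l m k) i)) (sym (++-assoc-eqFree Φ Θ Ψ)))
            (lookup-cast (+-assoc l m k) ((Φ ++ Θ) ++ Ψ) i)) E

    frontier-∥ : ∀ {l m} {Φ : Vec Formula l} {Ψ : Vec Formula m} {S : ProofStructure Φ} {T : ProofStructure Ψ}
                 (E : Embedding S) (F : Embedding T)
                 (disjoint : ∀ {v} → Embedding.Covered E v → ¬ Embedding.Covered F v) x →
                 Embedding.frontier (∥-embedding {S = S} {T = T} E F disjoint) x ≡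
                 [ Embedding.frontier E , Embedding.frontier F ]′ (splitAt l x)
    frontier-∥ {l = l} E F disjoint x with splitAt l x
    ... | inj₁ i = refl
    ... | inj₂ j = refl

    -- Compared as numbers, positions `m` and `m + 1` of the regrouped sequent are the last one of
    -- the left sequent and, by `regroup-right`, the first one of the right sequent.
    regroup-left : ∀ m n → splitAt (m + 1) (Fin.cast (sym (+-assoc m 1 (suc n))) (m ↑ʳ 0F)) ≡ inj₁ (m ↑ʳ 0F)
    regroup-left m n = trans (cong (splitAt (m + 1)) (toℕ-injective (trans (toℕ-cast _ _) (trans (toℕ-↑ʳ m _)
      (sym (trans (toℕ-↑ˡ (m ↑ʳ 0F) (suc n)) (toℕ-↑ʳ m 0F))))))) (splitAt-↑ˡ (m + 1) (m ↑ʳ 0F) (suc n))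

    regroup-right : ∀ m n → splitAt (m + 1) (Fin.cast (sym (+-assoc m 1 (suc n))) (m ↑ʳ 1F)) ≡ inj₂ 0F
    regroup-right m n = trans (cong (splitAt (m + 1)) (toℕ-injective (trans (toℕ-cast _ _) (trans (toℕ-↑ʳ m _)
      (sym (trans (toℕ-↑ʳ (m + 1) 0F) (+-identityʳ (m + 1)))))))) (splitAt-↑ʳ (m + 1) (suc n) 0F)

    module _ {l k : ℕ} {Φ : Vec Formula l} {Ψ : Vec Formula k} {A B : Formula}
             (Q₀ : Partial (Φ ++ A ∷ [])) (Q₁ : Partial (B ∷ Ψ)) {v : Node} (e : label v ≡ tensor)
             (disjoint : ∀ {u} → Covered Q₀ u → ¬ Covered Q₁ u) (fresh₀ : ¬ Covered Q₀ v) (fresh₁ : ¬ Covered Q₁ v)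
             (h₀ : frontier Q₀ (l ↑ʳ 0F) ≡ premiseAs e 0F) (h₁ : frontier Q₁ 0F ≡ premiseAs e 1F)
             (t : type (conclusionAs e 0F) ≡ A ⊗ B) where

      private
        π = ⊗-rule {Γ = Φ} {A = A} {B = B} {Δ = Ψ} (proof Q₀) (proof Q₁)

        E₀₁ : Embedding (proof Q₀ ° ∥ proof Q₁ °)
        E₀₁ = ∥-embedding {S = proof Q₀ °} {T = proof Q₁ °} (embedding Q₀) (embedding Q₁) disjoint

        S : ProofStructure (Φ ++ A ∷ B ∷ Ψ)
        S = regroup Φ (A ∷ []) (B ∷ Ψ) (proof Q₀ ° ∥ proof Q₁ °)

        E₁ : Embedding S
        E₁ = regroup-embedding Φ (A ∷ []) (B ∷ Ψ) {S = proof Q₀ ° ∥ proof Q₁ °} E₀₁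

        frontier-E₁ : ∀ i → Embedding.frontier E₁ i ≡
                      [ frontier Q₀ , frontier Q₁ ]′ (splitAt (l + 1) (Fin.cast (sym (+-assoc l 1 (suc k))) i))
        frontier-E₁ i = frontier-∥ {S = proof Q₀ °} {T = proof Q₁ °} (embedding Q₀) (embedding Q₁) disjoint _

        fresh₀₁ : ¬ Embedding.Covered E₁ v
        fresh₀₁ (inj₁ u , d) = fresh₀ (u , d)
        fresh₀₁ (inj₂ u , d) = fresh₁ (u , d)

        fits : ∀ q → Embedding.frontier E₁ (l ↑ʳ (q ↑ˡ k)) ≡ premiseAs e q
        fits 0F = trans (frontier-E₁ _) (trans (cong [ frontier Q₀ , frontier Q₁ ]′ (regroup-left l k)) h₀)
        fits 1F = trans (frontier-E₁ _) (trans (cong [ frontier Q₀ , frontier Q₁ ]′ (regroup-right l k)) h₁)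

        E : Embedding (π °)
        E = attach-embedding tensor Φ (A ∷ B ∷ []) (A ⊗ B ∷ []) Ψ (λ _ ()) refl
              {S = S} E₁ e fresh₀₁ fits
              (λ { 0F → t })

      tensor-partial : Partial (Φ ++ A ⊗ B ∷ Ψ)
      tensor-partial = record { proof = π ; valid = sequent-polarized E , valid Q₀ , valid Q₁ ; embedding = E }

      tensor-covered : ∀ {u} → Covered tensor-partial u ⇔ (u ≡ v ⊎ Covered Q₀ u ⊎ Covered Q₁ u)
      tensor-covered = mk⇔
        (λ { (inj₁ (inj₁ x) , d) → inj₂ (inj₁ (x , d))
           ; (inj₁ (inj₂ x) , d) → inj₂ (inj₂ (x , d))
           ; (inj₂ _ , d)        → inj₁ (sym d) })
        (λ { (inj₁ d)              → inj₂ tt , sym d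
           ; (inj₂ (inj₁ (x , d))) → inj₁ (inj₁ x) , d
           ; (inj₂ (inj₂ (x , d))) → inj₁ (inj₂ x) , d })

    module Box {v : Node} {k : ℕ} (e : label v ≡ box k) where

      open Content (content R v e)

      π₀ : Proof Θ
      π₀ = proj₁ (boxes-sequentializable v e)

      A : Formula
      A = lookup Θ (door ⟨$⟩ʳ zero)

      C : Vec Formula k
      C = tabulate λ j → proj₁ (proj₂ (typedAs e) j)

      auxiliary : ∀ j → type (conclusionAs e (suc j)) ≡ lookup (map ⁇_ C) j
      auxiliary j = trans (proj₂ (proj₂ (typedAs e) j))
                          (sym (trans (lookup-map j ⁇_ C) (cong ⁇_ (lookup∘tabulate _ j))))

      door-type : ∀ j → lookup (map ⁇_ C ++ A ∷ []) (rotate k ⟨$⟩ʳ j) ≡ lookup Θ (door ⟨$⟩ʳ j)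
      door-type zero    = rotate-first (map ⁇_ C) A
      door-type (suc j) = trans (rotate-other (map ⁇_ C) A j) (trans (sym (auxiliary j)) (auxiliary-type j))

      -- Undoes `door`, which puts the principal conclusion first, and then moves that conclusion to
      -- the end, where promotion expects it.
      ρ : Permutation width (k + 1)
      ρ = flip door ∘ₚ rotate k

      ρ-type : ∀ i → lookup (map ⁇_ C ++ A ∷ []) (ρ ⟨$⟩ʳ i) ≡ lookup Θ i
      ρ-type i = trans (door-type (door ⟨$⟩ˡ i)) (cong (lookup Θ) (inverseʳ door))

      π₁ : Proof (map ⁇_ C ++ A ∷ [])
      π₁ = exchange ρ ρ-type π₀

      π : Proof (map ⁇_ C ++ ! A ∷ [])
      π = promotion {Γ = C} {A = A} π₁

      body≅ : π₁ ° ≅⟨ flip (rotate k) ∘ₚ id ∘ₚ door ⟩ body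
      body≅ = ≅-reorder ρ ρ-type (λ i → trans (cong (door ⟨$⟩ʳ_) (inverseˡ (rotate k))) (inverseʳ door))
                (proj₂ (proj₂ (boxes-sequentializable v e)))

      E : Embedding (π °)
      E = record
        { node           = λ _ → v
        ; node-injective = λ _ → refl
        ; label≡         = λ _ → e
        ; type≡          = λ { (_ , zero) → principal-type ; (_ , suc j) → auxiliary j }
        ; wired          = λ ()
        -- The content is wanted at `trans e refl`, while `body≅` speaks of the one at `e`.
        ; boxes          = λ { _ refl → subst (λ e′ → let c′ = content R v e′ in
                                           π₁ ° ≅⟨ flip (rotate k) ∘ₚ id ∘ₚ Content.door c′ ⟩ Content.body c′)
                                         (≡-irrelevant _ _) body≅ }
        }

      box-partial : Partial (map ⁇_ C ++ ! A ∷ [])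
      box-partial = record
        { proof     = π
        ; valid     = sequent-polarized E , ++⁺ (++ˡ⁻ (map ⁇_ C) (sequent-polarized E)) (A-polarized ∷ []) ,
                      proj₁ (proj₂ (boxes-sequentializable v e))
        ; embedding = E
        }
        where
        A-polarized : Polarized A
        A-polarized = polarized-closed (!↓ here) (lookup⁺ (++ʳ⁻ (map ⁇_ C) (sequent-polarized E)) 0F)

    module _ {v : Node} where

      ax-partial : (e : label v ≡ ax) → let A = type (conclusionAs e 0F) in Partial (A ∷ A ^⊥ ∷ [])
      ax-partial e = record { proof = π ; valid = sequent-polarized E ; embedding = E }
        where
        π = axiom (type (conclusionAs e 0F))
        E : Embedding (π °)
        E = record
          { node = λ _ → v ; node-injective = λ _ → refl ; label≡ = λ _ → e
          ; type≡ = λ { (_ , 0F) → refl ; (_ , 1F) → typedAs e } ; wired = λ () ; boxes = λ _ () }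

      one-partial : label v ≡ one → Partial (𝟏 ∷ [])
      one-partial e = record { proof = 𝟏-rule ; valid = sequent-polarized E ; embedding = E }
        where
        E : Embedding (𝟏-rule °)
        E = record
          { node = λ _ → v ; node-injective = λ _ → refl ; label≡ = λ _ → e
          ; type≡ = λ { (_ , 0F) → typedAs e } ; wired = λ () ; boxes = λ _ () }

    -- The tree of ⊗ nodes above a core node.

    infix 4 _⊸_ _⊸*_

    _⊸_ : Node → Node → Set
    u ⊸ w = ∃₂ λ p q → to target (u , p) ≡ inj₁ (w , q) × label w ≡ tensor

    _⊸*_ : Node → Node → Set
    _⊸*_ = Star _⊸_

    ⊸-deterministic : ∀ {u v w} → u ⊸ v → u ⊸ w → v ≡ w
    ⊸-deterministic (p , q , e , t) (p′ , q′ , e′ , t′)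
      with refl ← tensor-unique (subst (IntoTensor G) (sym e) t) (subst (IntoTensor G) (sym e′) t′)
      with refl ← trans (sym e) e′ = refl

    ⊸*-step : ∀ {u v w} → u ⊸* v → v ⊸ w → TransClosure (_↝_ label target) u w
    ⊸*-step ε                     (p , q , e , _) = [ p , q , e ]
    ⊸*-step ((p , q , e , _) ◅ s) t               = (p , q , e) ∷ ⊸*-step s t

    ⊸-irreflexive : ∀ {v w} → v ⊸* w → ¬ w ⊸ v
    ⊸-irreflexive s t = ↝-acyclic G _ (⊸*-step s t)

    -- The covered nodes are pinned down exactly: `sound` keeps the two subtrees of a ⊗ disjoint and
    -- the ⊗ itself fresh, and `complete` ensures that its premises are available.
    record Tree (v : Node) : Set where
      field
        {width}   : ℕ
        {sequent} : Vec Formula width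
        partial   : Partial sequent
        sound     : ∀ {u} → Covered partial u → u ⊸* v
        complete  : ∀ {u} → u ⊸* v → Covered partial u

    leaf-⊸* : ∀ {u v} → label v ≢ tensor → u ⊸* v → v ≡ u
    leaf-⊸* ¬t s with unsnoc s
    ... | inj₁ refl                       = refl
    ... | inj₂ (_ , _ , _ , _ , _ , t) = contradiction t ¬t

    leaf-tree : ∀ {v ℓ} → label v ≡ ℓ → ℓ ≢ tensor → {Δ : Vec Formula m} (P : Partial Δ) →
                (∀ x → node P x ≡ v) → Ground.Node (ground (proof P °)) → Tree v
    leaf-tree {v = v} e ¬t P h x = record
      { partial  = P
      ; sound    = λ { (y , refl) → subst (_⊸* v) (sym (h y)) ε }
      ; complete = λ s → x , trans (h x) (leaf-⊸* (λ t → ¬t (trans (sym e) t)) s)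
      }

    module TensorTree {v : Node} (e : label v ≡ tensor) (tree : ∀ q → Tree (proj₁ (premiseAs e q))) where

      open Tree

      w : Fin 2 → Node
      w q = proj₁ (premiseAs e q)

      w⊸v : ∀ q → w q ⊸ v
      w⊸v q = _ , _ , target-premiseAs e q , e

      -- If the two nodes were equal, then by `tensor-unique` the two premises would be one arc. On
      -- a longer path the first step would lead to `v` by determinism, and the path would close
      -- into a cycle through `v`.
      w-distinct : ¬ w 0F ⊸* w 1F × ¬ w 1F ⊸* w 0F
      w-distinct = distinct (λ ()) , distinct (λ ())
        where
        premise-unique : ∀ {a b : Arc} → IntoTensor G (to target a) → IntoTensor G (to target b) →
                         proj₁ a ≡ proj₁ b → a ≡ b
        premise-unique {_ , p} t t′ refl = cong (_ ,_) (tensor-unique t t′)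
        into : ∀ q → IntoTensor G (to target (premiseAs e q))
        into q = subst (IntoTensor G) (sym (target-premiseAs e q)) e
        distinct : ∀ {p q} → p ≢ q → ¬ w p ⊸* w q
        distinct {p} {q} ne s = case start s of λ where
            (inj₁ d)             → ne (premiseAs-injective e (premise-unique (into p) (into q) d))
            (inj₂ (_ , t , s′)) → ⊸-irreflexive (subst (_⊸* w q) (⊸-deterministic t (w⊸v p)) s′) (w⊸v q)
          where
          start : ∀ {x y} → x ⊸* y → x ≡ y ⊎ ∃[ z ] x ⊸ z × z ⊸* y
          start ε       = inj₁ refl
          start (t ◅ s) = inj₂ (_ , t , s)

      P : ∀ q → Partial (sequent (tree q))
      P q = partial (tree q)

      fresh : ∀ q → ¬ Covered (P q) v
      fresh q c = ⊸-irreflexive (sound (tree q) c) (w⊸v q)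

      -- A node in both trees has `⊸`-paths to both premises; these are comparable, so one premise
      -- would lie above the other.
      disjoint : ∀ {u} → Covered (P 0F) u → ¬ Covered (P 1F) u
      disjoint c d with deterministic-linear ⊸-deterministic (sound (tree 0F) c) (sound (tree 1F) d)
      ... | inj₁ s = proj₁ w-distinct s
      ... | inj₂ s = proj₂ w-distinct s

      index : ∀ q → ∃[ i ] frontier (P q) i ≡ premiseAs e q
      index q = covered-premise (P q) (fresh q) (target-premiseAs e q) (complete (tree q) ε)

    module _ {m : ℕ} {Δ : Vec Formula m} (P : Partial Δ) (i : Fin m) {A : Formula} (t : type (frontier P i) ≡ A) where

      private
        ψ = separate {1} (λ _ → i) λ { {0F} {0F} _ → refl }

        fits : (q : Fin 1) → type (frontier P i) ≡ lookup (A ∷ []) q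
        fits 0F = t

        open Arrange P (proj₁ (proj₂ ψ)) (A ∷ []) fits

      put-last : ∃₂ λ c (Φ : Vec Formula c) → Σ[ Q ∈ Partial (Φ ++ A ∷ []) ]
                   (∀ {u} → Covered P u ⇔ Covered Q u) × frontier Q (c ↑ʳ 0F) ≡ frontier P i
      put-last = _ , rest , last , mk⇔ (λ d → d) (λ d → d) , frontier-last 0F

      put-first : ∃₂ λ c (Φ : Vec Formula c) → Σ[ Q ∈ Partial (A ∷ Φ) ]
                    (∀ {u} → Covered P u ⇔ Covered Q u) × frontier Q 0F ≡ frontier P i
      put-first = _ , rest , first , mk⇔ (λ d → d) (λ d → d) , frontier-first 0F

    tensor-tree : {v : Node} (e : label v ≡ tensor) → (∀ q → Tree (proj₁ (premiseAs e q))) → Tree v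
    tensor-tree {v} e tree =
      let i₀ , d₀ = index 0F
          i₁ , d₁ = index 1F
          _ , _ , Q₀ , c₀ , h₀ = put-last (P 0F) i₀ refl
          _ , _ , Q₁ , c₁ , h₁ = put-first (P 1F) i₁ refl
          disjoint′ = λ {u} (c : Covered Q₀ u) d → disjoint (Equivalence.from c₀ c) (Equivalence.from c₁ d)
          fresh₀ = fresh 0F ∘ Equivalence.from c₀
          fresh₁ = fresh 1F ∘ Equivalence.from c₁
          f₀ = trans h₀ d₀
          f₁ = trans h₁ d₁
          t = trans (typedAs e) (sym (cong₂ _⊗_ (cong type d₀) (cong type d₁)))
          covered = λ {u} → tensor-covered Q₀ Q₁ e disjoint′ fresh₀ fresh₁ f₀ f₁ t {u}
      in record
        { partial  = tensor-partial Q₀ Q₁ e disjoint′ fresh₀ fresh₁ f₀ f₁ t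
        ; sound    = λ c → case Equivalence.to covered c of λ where
            (inj₁ refl)     → ε
            (inj₂ (inj₁ c)) → sound (tree 0F) (Equivalence.from c₀ c) ◅◅ w⊸v 0F ◅ ε
            (inj₂ (inj₂ c)) → sound (tree 1F) (Equivalence.from c₁ c) ◅◅ w⊸v 1F ◅ ε
        ; complete = λ s → Equivalence.from covered
            (Sum.map₂ (Sum.map (Equivalence.to c₀) (Equivalence.to c₁)) (above s))
        }
      where
      open TensorTree e tree
      open Tree
      which : ∀ {ℓ x} (e : label v ≡ ℓ) → ℓ ≡ tensor → (q : Fin (#in (label v))) → x ≡ premise v q →
              ∃[ q ] x ≡ premiseAs e q
      which refl _ q d = q , d
      above : ∀ {u} → u ⊸* v → u ≡ v ⊎ Covered (P 0F) u ⊎ Covered (P 1F) u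
      above s with unsnoc s
      ... | inj₁ d = inj₁ d
      ... | inj₂ (x , s′ , p , q , d , _) with which e refl q (premise-target G d)
      ...   | 0F , refl = inj₂ (inj₁ (complete (tree 0F) s′))
      ...   | 1F , refl = inj₂ (inj₂ (complete (tree 1F) s′))

    core-tree : ∀ {v} → Acc (_↝_ label target) v → ∀ ℓ → label v ≡ ℓ → Core ℓ → Tree v
    core-tree a ax      e _ = leaf-tree e (λ ()) (ax-partial e) (λ _ → refl) tt
    core-tree a one     e _ = leaf-tree e (λ ()) (one-partial e) (λ _ → refl) tt
    core-tree a (box k) e _ = leaf-tree e (λ ()) (Box.box-partial e) (λ _ → refl) tt
    core-tree (acc rec) tensor e _ = tensor-tree e λ q →
      core-tree (rec (_ , _ , target-premiseAs e q)) _ refl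
        (tensor-core (subst (IntoTensor G) (sym (target-premiseAs e q)) e))

    -- Going down from ⊗ to ⊗ stops by acyclicity, and a core node that feeds no ⊗ is a focus.
    focus-below : ∀ {u} → Acc (Function.flip (_↝_ label target)) u → Core (label u) → ∃[ f ] Focus G f × u ⊸* f
    focus-below {u} (acc rec) c with feedsTensor? G u
    ... | no ¬t = u , (c , fromWitnessFalse ¬t) , ε
    ... | yes (p , t) with to target (u , p) in eq
    ...   | inj₁ (w , q) = let f , F , s = focus-below (rec (p , q , eq)) (subst Core (sym t) tensor) in
                           f , F , (p , q , eq , t) ◅ s

    focus : Foci G
    focus = to one-focus 0F

    focus-unique : ∀ f → f ≡ focus
    focus-unique f with from one-focus f in eq
    ... | 0F = trans (sym (strictlyInverseˡ one-focus f)) (cong (to one-focus) eq)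

    CoreCovered : State → Set
    CoreCovered S = ∀ {u} → Core (label u) → Covered (partial S) u

    -- Every core node lies above some focus, hence above the only one, whose tree therefore
    -- contains the whole core.
    start : ∃[ S ] CoreCovered S
    start = state (Tree.partial tree) , λ c → let f , F , s = focus-below (↝-noetherian G _) c in
                                        Tree.complete tree (subst (_ ⊸*_) (cong proj₁ (focus-unique (f , F))) s)
      where tree = core-tree (↝-wellFounded G (proj₁ focus)) _ refl (proj₁ (proj₂ focus))

    -- Covering the remaining nodes in topological order.

    _≟ᴺ_ : DecidableEquality Node
    _≟ᴺ_ = via-injection (↔⇒↣ (↔-sym nodes)) Fin._≟_

    covered? : ∀ (P : Partial Δ) v → Dec (Covered P v)
    covered? P v = map′ (λ (i , e) → to nodes′ i , e)
                        (λ (u , e) → from nodes′ u , trans (cong (node P) (strictlyInverseˡ nodes′ u)) e)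
                        (any? λ i → node P (to nodes′ i) ≟ᴺ v)
      where nodes′ = Ground.nodes (ground (proof P °))

    -- The result need not repeat `CoreCovered`, which passes from `S` to `T` along `⊆`.
    Growth : (State → Set) → Set
    Growth Goal = ∀ S → CoreCovered S → ∃[ T ] S ⊆ T × Goal T

    cover-all : ∀ {k} (f : Fin k → Node) → (∀ q → Growth λ T → Covered (partial T) (f q)) →
                Growth λ T → ∀ q → Covered (partial T) (f q)
    cover-all {zero}  f g S c = S , (λ d → d) , λ ()
    cover-all {suc k} f g S c with g zero S c
    ... | T , S⊆T , d with cover-all (f ∘ suc) (g ∘ suc) T (S⊆T ∘ c)
    ...   | U , T⊆U , ds = U , T⊆U ∘ S⊆T , λ { zero → T⊆U d ; (suc q) → ds q }

    cover : ∀ {v} → Acc (_↝_ label target) v → Growth λ T → Covered (partial T) v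
    cover {v} (acc rec) S c
      with cover-all (λ q → proj₁ (premise v q)) (λ q → cover (rec (_ , _ , target-premise G v q))) S c
    -- The node may be covered already, in particular when it is core. If it is not, then it lies
    -- outside the core and all its premises are on the frontier, so one rule adds it.
    ... | T , S⊆T , ds with covered? (partial T) v
    ...   | yes d = T , S⊆T , d
    ...   | no ¬d =
      let U , T⊆U , d = add (partial T) (¬d , λ e q → covered-premise (partial T) ¬d (target-premiseAs e q) (ds _))
                            (λ core → ¬d (S⊆T (c core))) _ refl
      in U , T⊆U ∘ S⊆T , d

    full : ∃[ S ] ∀ v → Covered (partial S) v
    full with cover-all (to nodes) (λ q → cover (↝-wellFounded G _)) (proj₁ start) (proj₂ start)
    ... | T , _ , d = T , λ v → subst (Covered (partial T)) (strictlyInverseˡ nodes v) (d (from nodes v))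

    sequentializable : Sequentializable LLpol R
    sequentializable = proof Q , valid Q , complete-≅ (embedding Q) covered λ j →
        trans (sym (frontier-order _)) (cong outer (inverseʳ order))
      where
      P = partial (proj₁ full)
      open Complete (embedding P) (proj₂ full)
      covered : ∀ v → Covered P v
      covered = proj₂ full
      Q : Partial Γ
      Q = permute order (λ i → trans (sym (outer-type _)) (trans (cong type (frontier-order i)) (frontier-type P i))) P

  -- The two implications, at all depths.

  SequentializableGround : GroundProperty
  SequentializableGround G = CutFreePolarizedGround G × (Fin 1 ↔ Foci G)

  mutual
    one-focus⇒sequentializable : (R : ProofStructure Γ) → Everywhere SequentializableGround R → Sequentializable LLpol R
    one-focus⇒sequentializable (ps G c) h = Construction.sequentializable (ps G c) cut-free polarized one-focus
      λ v e → one-focus⇒content-sequentializable (c v e) (in-boxes h v e)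
      where
      cut-free  = proj₁ (proj₁ (at-ground h))
      polarized = proj₂ (proj₁ (at-ground h))
      one-focus = proj₂ (at-ground h)

    one-focus⇒content-sequentializable :
      {G : Ground Γ} {v : Ground.Node G} {e : Ground.label G v ≡ box k} (c : Content G v e) →
      Everywhere SequentializableGround (Content.body c) → Sequentializable LLpol (Content.body c)
    one-focus⇒content-sequentializable (boxContent body _ _ _) = one-focus⇒sequentializable body

  cutFreePolarized : (R : ProofStructure Γ) → CutFree R → PSOf LLpol R → Everywhere CutFreePolarizedGround R
  cutFreePolarized R = everywhere-zip
    {P = λ G → ∀ v → Ground.label G v ≢ cut} {Q = λ G → ∀ a → Polarized (Ground.type G a)} (λ _ → _,_) R

  ACC⇒sequentializable : (R : ProofStructure Γ) → Everywhere CutFreePolarizedGround R →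
                         ACC♯w R → Sequentializable LLpol R
  ACC⇒sequentializable R h h′ = one-focus⇒sequentializable R
    (everywhere-zip {P = CutFreePolarizedGround} {Q = ACC♯w-ground} {T = SequentializableGround}
      (λ G p acc♯w → p , CutFreePolarized.ACC⇒one-focus G (proj₁ p) (proj₂ p) acc♯w) R h h′)

  sequentializable⇒ACC : (R : ProofStructure Γ) → Everywhere CutFreePolarizedGround R →
                         Sequentializable LLpol R → ACC♯w R
  sequentializable⇒ACC R h (π , _ , i) =
    everywhere-zip {P = BalancedGround} {Q = CutFreePolarizedGround} balanced⇒ACC R
      (≅-everywhere-balanced R i (proof-balanced π)) h

corollary72 : (𝒜 : Atoms) → let open MELL 𝒜 in
    {n : ℕ} {Γ : Vec Formula n} (R : ProofStructure Γ) →
    CutFree R → PSOf LLpol R →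
    ACC♯w R ⇔ Sequentializable LLpol R
corollary72 𝒜 R cut-free polarized = mk⇔ (ACC⇒sequentializable 𝒜 R h) (sequentializable⇒ACC 𝒜 R h)
  where h = cutFreePolarized 𝒜 R cut-free polarized
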